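{- Let $k\ge 1$ be an integer, let $U_n:=K_3\times P_n$ for $n\ge 1$, and let $T(x,y):=\sum_{n\geq 1}x^{n}\sum_{T\in\mathcal{T}^{(k)}(U_n)} y^{\rho(T)}$. Then $T(x,y)=p(x,y)/q(x,y)$, where \begin{multline*} p(x,y)= k x y \Bigl(1 - (1 - k) y (3 - (2 - k) y) - x (1 - y) \bigl(4 - y (13 - 5 k) + (3 + k) (3 - 2 k) y^2 \\ - (1 - k) (1 + (3 - k) k) y^3\bigr) + x^2 (1 - y)^2 \bigl(3 - (2 + 4 k) y + (1 - k + 3 k^2) y^2 + k^2 (1 - k ) y^3\bigr)\Bigr) \end{multline*} and \begin{multline*} q(x,y)= 1 - x \Bigl(5 - 12 (2 - k) y + x^2 (1 - y)^2 \bigl(3 - (2 + 4 k) y + k (1 + 2 k) y^2 + k (1 - k ) y^3 - (k - 1)^4 y^4\bigr) \\ - x (1 - y) \bigl(7 - (25 - 8 k) y + (20 - 3 k - 4 k^2) y^2 + (5 - 24 k + 21 k^2 - 5 k^3) y^3 - (7 - 18 k + 17 k^2 - 7 k^3 + k^4) y^4\bigr) \\ + y^2 \bigl(32 - 26 k + 6 k^2 - (13 - 14 k + 6 k^2 - k^3) y\bigr)\Bigr). \end{multline*} Moreover, $[x^n]T(x,1)=k^{3n}$ for all $n\ge 1$.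
   Context: $K_m$ is the complete graph on $m$ vertices and $P_n$ the path graph on $n$ vertices. The product $G_1\times G_2$ of graphs $G_1=(V_1,E_1)$, $G_2=(V_2,E_2)$ is the Cartesian product: its vertex set is $V_1\times V_2$, and $(v_1,v_2),(w_1,w_2)$ are adjacent iff ($v_1=w_1$ and $\{v_2,w_2\}\in E_2$) or ($v_2=w_2$ and $\{v_1,w_1\}\in E_1$). For a finite undirected graph $G=(V,E)$, two nonempty disjoint subsets $V_1,V_2\subseteq V$ are neighbors if there is an edge of $G$ with one endpoint in $V_1$ and the other in $V_2$. A $k$-colored partition of $G$ is a partition $V=\bigcup_{i=1}^s V_i$ together with an assignment of one of $k$ colors to each $V_i$ (all vertices of $V_i$ get that color), such that each $V_i$ induces a connected subgraph of $G$ and any two neighboring sets $V_i,V_j$ have different colors. The sets $V_i$ are the blocks, and the size $\rho(T)$ of a $k$-colored partition $T$ is its number of blocks. $\mathcal{T}^{(k)}(G)$ denotes the set of all $k$-colored partitions of $G$. Generating functions are formal power series in $x$ with coefficients polynomial in $y$; $[x^n]$ denotes coefficient extraction. -}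

module Defs where

open import Data.Empty using (⊥-elim)
open import Data.Fin using (Fin; toℕ)
import Data.Fin.Properties as Fin
open import Data.Integer using (ℤ; +_)
import Data.Integer as ℤ
open import Data.List using (List; []; _∷_; map; lookup; length; foldr; upTo; allFin; replicate; concatMap; cartesianProduct; cartesianProductWith; deduplicate; _++_)
open import Data.List.Membership.Propositional using (_∈_; lose)
open import Data.List.Membership.Propositional.Properties using (∈-allFin; ∈-cartesianProduct⁺; ∈-cartesianProductWith⁺; ∈-concatMap⁺; ∈-upTo⁺; ∈-map⁺)
import Data.List.Membership.Setoid as SetoidMembership
import Data.List.Membership.Setoid.Properties as SetoidMembershipₚ
import Data.List.Relation.Unary.All as All
open import Data.List.Relation.Unary.Any as Any using (here; there; index)
open import Data.List.Relation.Unary.Any.Properties using (lookup-index)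
import Data.List.Relation.Unary.Unique.Setoid as SetoidUnique
open import Data.List.Relation.Unary.Unique.DecSetoid.Properties using (deduplicate-!)
open import Data.Nat using (ℕ; zero; suc; _≤_; _∸_; s≤s)
import Data.Nat as ℕ
open import Data.Product using (Σ; ∃; ∃₂; _×_; _,_; proj₁; proj₂)
open import Data.Product.Properties using (≡-dec)
open import Data.Sum using (_⊎_; inj₁; inj₂)
open import Function using (_∘_; _⇔_; mk⇔; Equivalence)
open import Level using (0ℓ)
open import Relation.Binary.Bundles using (Setoid; DecSetoid)
open import Relation.Binary.Construct.Closure.ReflexiveTransitive using (Star; ε; _◅_; _◅◅_; gmap)
open import Relation.Binary.Definitions using (Decidable; DecidableEquality)
open import Relation.Binary.PropositionalEquality using (_≡_; _≢_; _≗_; refl; sym; trans; cong; subst; subst₂)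
open import Relation.Nullary using (Dec; yes; no; ¬?; _×-dec_; _⊎-dec_; _→-dec_)
open import Relation.Nullary.Decidable using (map′)
open import Relation.Unary using (Pred)
import Relation.Unary as Unary

------------------------------------------------------------------------
-- Graphs

record Graph : Set₁ where
  field
    Vertex : Set
    Adj    : Vertex → Vertex → Set
    symm   : ∀ {u v} → Adj u v → Adj v u

open Graph

complete : ℕ → Graph
complete m = record
  { Vertex = Fin m
  ; Adj    = _≢_
  ; symm   = λ u≢v v≡u → u≢v (sym v≡u)
  }

path : ℕ → Graph
path n = record
  { Vertex = Fin n
  ; Adj    = λ i j → suc (toℕ i) ≡ toℕ j ⊎ suc (toℕ j) ≡ toℕ i
  ; symm   = λ { (inj₁ e) → inj₂ e ; (inj₂ e) → inj₁ e }
  }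

infixr 7 _□_

_□_ : Graph → Graph → Graph
G₁ □ G₂ = record
  { Vertex = Vertex G₁ × Vertex G₂
  ; Adj    = λ { (v₁ , v₂) (w₁ , w₂) → (v₁ ≡ w₁ × Adj G₂ v₂ w₂) ⊎ (v₂ ≡ w₂ × Adj G₁ v₁ w₁) }
  ; symm   = λ { (inj₁ (e , a)) → inj₁ (sym e , symm G₂ a)
               ; (inj₂ (e , a)) → inj₂ (sym e , symm G₁ a) }
  }

U : ℕ → Graph
U n = complete 3 □ path n

induced : (G : Graph) → Pred (Vertex G) 0ℓ → Graph
induced G P = record
  { Vertex = Σ (Vertex G) P
  ; Adj    = λ u v → Adj G (proj₁ u) (proj₁ v)
  ; symm   = symm G
  }

Connected : Graph → Set
Connected G = ∀ u v → Star (Adj G) u v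

-- Only applied to nonempty disjoint sets.
Neighbors : (G : Graph) → (P Q : Pred (Vertex G) 0ℓ) → Set
Neighbors G P Q = ∃₂ λ u v → P u × Q v × Adj G u v

record IsFinite (G : Graph) : Set where
  field
    vertices   : List (Vertex G)
    ∈-vertices : ∀ v → v ∈ vertices
    _≟_        : DecidableEquality (Vertex G)
    adj?       : Decidable (Adj G)

------------------------------------------------------------------------
-- Colored partitions

Fiber : {A B : Set} → (A → B) → B → Pred A 0ℓ
Fiber f i v = f v ≡ i

-- The blocks are V_i = Fiber block i, for i : Fin s.
record IsColoredPartition (G : Graph) {k s : ℕ}
         (block : Vertex G → Fin s) (color : Fin s → Fin k) : Set where
  field
    nonempty  : ∀ i → ∃ (Fiber block i)
    connected : ∀ i → Connected (induced G (Fiber block i))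
    proper    : ∀ i j → i ≢ j → Neighbors G (Fiber block i) (Fiber block j) → color i ≢ color j

record ColoredPartition (k : ℕ) (G : Graph) : Set where
  constructor coloredPartition
  field
    ρ                  : ℕ
    block              : Vertex G → Fin ρ
    color              : Fin ρ → Fin k
    isColoredPartition : IsColoredPartition G block color

open ColoredPartition using (ρ)

-- The numbering of the blocks is not part of the data: two colored partitions
-- are the same when they have the same blocks, equally colored.
record _≈ₜ_ {k G} (S T : ColoredPartition k G) : Set where
  constructor _,_
  private
    module S = ColoredPartition S
    module T = ColoredPartition T
  field
    sameBlocks : ∀ u v → (S.block u ≡ S.block v) ⇔ (T.block u ≡ T.block v)
    sameColors : ∀ v → S.color (S.block v) ≡ T.color (T.block v)

≈ₜ-setoid : ℕ → Graph → Setoid 0ℓ 0ℓ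
≈ₜ-setoid k G = record
  { Carrier = ColoredPartition k G
  ; _≈_     = _≈ₜ_
  ; isEquivalence = record
    { refl  = (λ _ _ → mk⇔ (λ e → e) (λ e → e)) , λ _ → refl
    ; sym   = λ (b , c) → (λ u v → mk⇔ (from (b u v)) (to (b u v))) , λ v → sym (c v)
    ; trans = λ (b , c) (b′ , c′) →
        (λ u v → mk⇔ (to (b′ u v) ∘ to (b u v)) (from (b u v) ∘ from (b′ u v)))
        , λ v → trans (c v) (c′ v)
    }
  }
  where open Equivalence

------------------------------------------------------------------------
-- The colored partitions of a finite graph form a finite set: `𝒯` lists them
-- without repetition, as witnessed by `𝒯-complete` and `𝒯-unique`.

module Finiteness where

  all-dec : ∀ {A : Set} {P : Pred A 0ℓ} (xs : List A) → (∀ v → v ∈ xs) →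
            Unary.Decidable P → Dec (∀ v → P v)
  all-dec xs c P? = map′ (λ a v → All.lookup a (c v)) (λ f → All.tabulate (λ {v} _ → f v)) (All.all? P? xs)

  any-dec : ∀ {A : Set} {P : Pred A 0ℓ} (xs : List A) → (∀ v → v ∈ xs) →
            Unary.Decidable P → Dec (∃ P)
  any-dec xs c P? = map′ Any.satisfied (λ (v , p) → lose (c v) p) (Any.any? P? xs)

  uip : ∀ {A : Set} {a b : A} (p q : a ≡ b) → p ≡ q
  uip refl refl = refl

  select : ∀ {A : Set} {P : Pred A 0ℓ} → Unary.Decidable P → List A → List (Σ A P)
  select P? [] = []
  select P? (x ∷ xs) with P? x
  ... | yes p = (x , p) ∷ select P? xs
  ... | no _  = select P? xs

  select-∈ : ∀ {A : Set} {P : Pred A 0ℓ} (P? : Unary.Decidable P) {x xs} →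
             x ∈ xs → P x → Σ (P x) λ p → (x , p) ∈ select P? xs
  select-∈ P? {x} (here refl) p with P? x
  ... | yes p′ = p′ , here refl
  ... | no ¬p  = ⊥-elim (¬p p)
  select-∈ P? {x} {y ∷ _} (there m) p with P? y
  ... | yes _ = let p′ , m′ = select-∈ P? m p in p′ , there m′
  ... | no _  = select-∈ P? m p

  -- Warshall's algorithm: walks all of whose interior vertices lie in a list.
  module Warshall {A : Set} {E : A → A → Set} (_≟_ : DecidableEquality A) (E? : Decidable E) where

    Via : List A → A → A → Set
    Via []       u v = u ≡ v ⊎ E u v
    Via (x ∷ xs) u v = Via xs u v ⊎ (Via xs u x × Via xs x v)

    via? : ∀ xs → Decidable (Via xs)
    via? []       u v = (u ≟ v) ⊎-dec E? u v
    via? (x ∷ xs) u v = via? xs u v ⊎-dec (via? xs u x ×-dec via? xs x v)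

    via⇒star : ∀ xs {u v} → Via xs u v → Star E u v
    via⇒star []       (inj₁ refl)    = ε
    via⇒star []       (inj₂ e)       = e ◅ ε
    via⇒star (x ∷ xs) (inj₁ w)       = via⇒star xs w
    via⇒star (x ∷ xs) (inj₂ (w , z)) = via⇒star xs w ◅◅ via⇒star xs z

    base : ∀ xs {u v} → u ≡ v ⊎ E u v → Via xs u v
    base []       b = b
    base (x ∷ xs) b = inj₁ (base xs b)

    via-trans : ∀ {xs u w v} → w ∈ xs → Via xs u w → Via xs w v → Via xs u v
    via-trans (here refl) a b = inj₂ (left a , right b)
      where
      left : ∀ {xs u x} → Via (x ∷ xs) u x → Via xs u x
      left (inj₁ a)       = a
      left (inj₂ (a , _)) = a
      right : ∀ {xs x v} → Via (x ∷ xs) x v → Via xs x v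
      right (inj₁ a)       = a
      right (inj₂ (_ , a)) = a
    via-trans (there m) (inj₁ a)       (inj₁ b)       = inj₁ (via-trans m a b)
    via-trans (there m) (inj₁ a)       (inj₂ (b , c)) = inj₂ (via-trans m a b , c)
    via-trans (there m) (inj₂ (a , b)) (inj₁ c)       = inj₂ (a , via-trans m b c)
    via-trans (there m) (inj₂ (a , _)) (inj₂ (_ , d)) = inj₂ (a , d)

    star⇒via : ∀ xs → (∀ v → v ∈ xs) → ∀ {u v} → Star E u v → Via xs u v
    star⇒via xs c ε       = base xs (inj₁ refl)
    star⇒via xs c (e ◅ s) = via-trans (c _) (base xs (inj₂ e)) (star⇒via xs c s)

    star? : ∀ xs → (∀ v → v ∈ xs) → Decidable (Star E)
    star? xs c u v = map′ (via⇒star xs) (star⇒via xs c) (via? xs u v)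

  connected? : ∀ {G} → IsFinite G → Dec (Connected G)
  connected? fin = all-dec vertices ∈-vertices λ u → all-dec vertices ∈-vertices λ v →
                   Warshall.star? _≟_ adj? vertices ∈-vertices u v
    where open IsFinite fin

  fiber-finite : ∀ {G s} → IsFinite G → (f : Vertex G → Fin s) → ∀ i → IsFinite (induced G (Fiber f i))
  fiber-finite fin f i = record
    { vertices   = select (λ v → f v Fin.≟ i) vertices
    ; ∈-vertices = λ (v , p) → let p′ , m = select-∈ (λ v → f v Fin.≟ i) (∈-vertices v) p in
                   subst (λ r → (v , r) ∈ select (λ v → f v Fin.≟ i) vertices) (uip p′ p) m
    ; _≟_        = ≡-dec _≟_ (λ p q → yes (uip p q))
    ; adj?       = λ u v → adj? (proj₁ u) (proj₁ v)
    }
    where open IsFinite fin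

  isColoredPartition? : ∀ {G k s} → IsFinite G → (b : Vertex G → Fin s) (c : Fin s → Fin k) →
                        Dec (IsColoredPartition G b c)
  isColoredPartition? fin b c = map′
    (λ (n , o , p) → record { nonempty = n ; connected = o ; proper = p })
    (λ r → let open IsColoredPartition r in nonempty , connected , proper)
    ( Fin.all? (λ i → any λ v → b v Fin.≟ i)
    ×-dec Fin.all? (λ i → connected? (fiber-finite fin b i))
    ×-dec Fin.all? (λ i → Fin.all? λ j → ¬? (i Fin.≟ j) →-dec
          (any (λ u → any λ v → (b u Fin.≟ i) ×-dec (b v Fin.≟ j) ×-dec adj? u v)
          →-dec ¬? (c i Fin.≟ c j))))
    where
    open IsFinite fin
    any : ∀ {P : Pred _ 0ℓ} → Unary.Decidable P → Dec (∃ P)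
    any = any-dec vertices ∈-vertices

  isColoredPartition-resp : ∀ {G k s} {b b′ : Vertex G → Fin s} {c c′ : Fin s → Fin k} →
    b ≗ b′ → c ≗ c′ → IsColoredPartition G b c → IsColoredPartition G b′ c′
  isColoredPartition-resp {G} {b = b} {b′} b≗b′ c≗c′ r = record
    { nonempty  = λ i → let v , p = nonempty i in v , trans (sym (b≗b′ v)) p
    ; connected = λ i (u , p) (v , q) →
        subst₂ (λ p q → Star (Adj (induced G (Fiber b′ i))) (u , p) (v , q)) (uip _ _) (uip _ _)
          (gmap (λ (w , e) → w , trans (sym (b≗b′ w)) e) (λ a → a)
            (connected i (u , trans (b≗b′ u) p) (v , trans (b≗b′ v) q)))
    ; proper    = λ i j i≢j (u , v , p , q , a) e →
        proper i j i≢j (u , v , trans (b≗b′ u) p , trans (b≗b′ v) q , a)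
          (trans (c≗c′ i) (trans e (sym (c≗c′ j))))
    }
    where open IsColoredPartition r

  functionsOn : {A B : Set} (xs : List A) → List B → List (∀ v → v ∈ xs → B)
  functionsOn []       ys = (λ _ ()) ∷ []
  functionsOn {A} {B} (x ∷ xs) ys = cartesianProductWith extend ys (functionsOn xs ys)
    where
    extend : B → (∀ v → v ∈ xs → B) → ∀ v → v ∈ x ∷ xs → B
    extend y f v (here _)  = y
    extend y f v (there m) = f v m

  functionsOn-complete : {A B : Set} (xs : List A) {ys : List B} → (∀ y → y ∈ ys) → (g : A → B) →
    ∃ λ f → f ∈ functionsOn xs ys × (∀ v m → f v m ≡ g v)
  functionsOn-complete []       c g = _ , here refl , λ _ ()
  functionsOn-complete (x ∷ xs) c g with functionsOn-complete xs c g
  ... | f , f∈ , f≗g = _ , ∈-cartesianProductWith⁺ _ (c (g x)) f∈ ,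
                       λ { v (here refl) → refl ; v (there m) → f≗g v m }

  functions : {A B : Set} (xs : List A) → (∀ v → v ∈ xs) → List B → List (A → B)
  functions xs c ys = map (λ f v → f v (c v)) (functionsOn xs ys)

  functions-complete : {A B : Set} (xs : List A) (c : ∀ v → v ∈ xs) {ys : List B} →
    (∀ y → y ∈ ys) → (g : A → B) → ∃ λ f → f ∈ functions xs c ys × f ≗ g
  functions-complete xs c d g = let f , f∈ , f≗g = functionsOn-complete xs d g in
    _ , ∈-map⁺ _ f∈ , λ v → f≗g v (c v)

  module Enumerate (k : ℕ) {G : Graph} (fin : IsFinite G) where
    open IsFinite fin
    open ColoredPartition hiding (ρ)
    open SetoidMembership (≈ₜ-setoid k G) using () renaming (_∈_ to _∈ₜ_)

    _≈ₜ?_ : Decidable (_≈ₜ_ {k} {G})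
    S ≈ₜ? T = map′ (λ (b , c) → b , c) (λ (b , c) → b , c)
      ( all-dec vertices ∈-vertices (λ u → all-dec vertices ∈-vertices λ v →
          map′ (λ (f , g) → mk⇔ f g) (λ e → Equivalence.to e , Equivalence.from e)
            (  (block S u Fin.≟ block S v →-dec block T u Fin.≟ block T v)
            ×-dec (block T u Fin.≟ block T v →-dec block S u Fin.≟ block S v)))
      ×-dec all-dec vertices ∈-vertices (λ v → color S (block S v) Fin.≟ color T (block T v)))

    decSetoid : DecSetoid 0ℓ 0ℓ
    decSetoid = record
      { Carrier = ColoredPartition k G
      ; _≈_     = _≈ₜ_
      ; isDecEquivalence = record { isEquivalence = Setoid.isEquivalence (≈ₜ-setoid k G) ; _≟_ = _≈ₜ?_ }
      }

    Candidate : ℕ → Set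
    Candidate s = (Vertex G → Fin s) × (Fin s → Fin k)

    Good : ∀ {s} → Pred (Candidate s) 0ℓ
    Good (b , c) = IsColoredPartition G b c

    candidates : ∀ s → List (Candidate s)
    candidates s = cartesianProduct (functions vertices ∈-vertices (allFin s))
                                    (functions (allFin s) ∈-allFin (allFin k))

    good? : ∀ {s} → Unary.Decidable (Good {s})
    good? (b , c) = isColoredPartition? fin b c

    toPartition : ∀ {s} → Σ (Candidate s) Good → ColoredPartition k G
    toPartition ((b , c) , r) = coloredPartition _ b c r

    ofSize : ℕ → List (ColoredPartition k G)
    ofSize s = map toPartition (select good? (candidates s))

    all : List (ColoredPartition k G)
    all = concatMap ofSize (upTo (suc (length vertices)))

    ρ-bound : (T : ColoredPartition k G) → ρ T ≤ length vertices
    ρ-bound T = Fin.injective⇒≤ {f = λ i → index (∈-vertices (rep i))} λ {i} {j} e →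
      trans (sym (proj₂ (nonempty i))) (trans (cong (block T) (index-inj e)) (proj₂ (nonempty j)))
      where
      open IsColoredPartition (isColoredPartition T)
      rep : Fin (ρ T) → Vertex G
      rep i = proj₁ (nonempty i)
      index-inj : ∀ {u v} → index (∈-vertices u) ≡ index (∈-vertices v) → u ≡ v
      index-inj {u} {v} e = trans (lookup-index (∈-vertices u))
        (trans (cong (lookup vertices) e) (sym (lookup-index (∈-vertices v))))

    all-complete : ∀ T → T ∈ₜ all
    all-complete T@(coloredPartition s b c r) =
      let b′ , b∈ , b≗ = functions-complete vertices ∈-vertices ∈-allFin b
          c′ , c∈ , c≗ = functions-complete (allFin s) ∈-allFin ∈-allFin c
          r₀ = isColoredPartition-resp (λ v → sym (b≗ v)) (λ i → sym (c≗ i)) r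
          r′ , m = select-∈ good? (∈-cartesianProduct⁺ b∈ c∈) r₀
          T∈ : coloredPartition s b′ c′ r′ ∈ all
          T∈ = ∈-concatMap⁺ ofSize (lose (∈-upTo⁺ (s≤s (ρ-bound T))) (∈-map⁺ toPartition m))
          T≈ : T ≈ₜ coloredPartition s b′ c′ r′
          T≈ = (λ u v → mk⇔ (λ e → trans (b≗ u) (trans e (sym (b≗ v))))
                            (λ e → trans (sym (b≗ u)) (trans e (b≗ v))))
               , λ v → trans (sym (c≗ (b v))) (cong c′ (sym (b≗ v)))
      in Any.map (λ { refl → T≈ }) T∈

open Finiteness

𝒯 : (k : ℕ) {G : Graph} → IsFinite G → List (ColoredPartition k G)
𝒯 k fin = deduplicate (Enumerate._≈ₜ?_ k fin) (Enumerate.all k fin)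

module _ (k : ℕ) {G : Graph} (fin : IsFinite G) where
  open SetoidMembership (≈ₜ-setoid k G) using () renaming (_∈_ to _∈ₜ_)
  open SetoidUnique (≈ₜ-setoid k G) using (Unique)

  𝒯-complete : ∀ T → T ∈ₜ 𝒯 k fin
  𝒯-complete T = SetoidMembershipₚ.∈-deduplicate⁺ (≈ₜ-setoid k G) (Enumerate._≈ₜ?_ k fin)
    (λ e z → Setoid.trans (≈ₜ-setoid k G) z (Setoid.sym (≈ₜ-setoid k G) e)) (Enumerate.all-complete k fin T)

  𝒯-unique : Unique (𝒯 k fin)
  𝒯-unique = deduplicate-! (Enumerate.decSetoid k fin) (Enumerate.all k fin)

U-finite : ∀ n → IsFinite (U n)
U-finite n = record
  { vertices   = cartesianProduct (allFin 3) (allFin n)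
  ; ∈-vertices = λ (i , j) → ∈-cartesianProduct⁺ (∈-allFin i) (∈-allFin j)
  ; _≟_        = ≡-dec Fin._≟_ Fin._≟_
  ; adj?       = λ (i , j) (i′ , j′) →
      ((i Fin.≟ i′) ×-dec ((suc (toℕ j) ℕ.≟ toℕ j′) ⊎-dec (suc (toℕ j′) ℕ.≟ toℕ j)))
      ⊎-dec ((j Fin.≟ j′) ×-dec ¬? (i Fin.≟ i′))
  }

------------------------------------------------------------------------
-- ℤ[y], as lists of coefficients in order of increasing degree (trailing
-- zeros allowed, hence the equality _≈ₚ_)

Poly : Set
Poly = List ℤ

coeff : Poly → ℕ → ℤ
coeff []      _       = + 0
coeff (a ∷ f) zero    = a
coeff (a ∷ f) (suc i) = coeff f i

infix 4 _≈ₚ_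
_≈ₚ_ : Poly → Poly → Set
f ≈ₚ g = ∀ i → coeff f i ≡ coeff g i

infixl 6 _+ₚ_
_+ₚ_ : Poly → Poly → Poly
[]      +ₚ g       = g
(a ∷ f) +ₚ []      = a ∷ f
(a ∷ f) +ₚ (b ∷ g) = a ℤ.+ b ∷ f +ₚ g

-ₚ_ : Poly → Poly
-ₚ f = map ℤ.-_ f

infixl 7 _*ₚ_
_*ₚ_ : Poly → Poly → Poly
[]      *ₚ g = []
(a ∷ f) *ₚ g = map (a ℤ.*_) g +ₚ (+ 0 ∷ f *ₚ g)

sumₚ : List Poly → Poly
sumₚ = foldr _+ₚ_ []

y^_ : ℕ → Poly
y^ s = replicate s (+ 0) ++ + 1 ∷ []

eval : Poly → ℤ → ℤ
eval []      a = + 0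
eval (b ∷ f) a = b ℤ.+ a ℤ.* eval f a

------------------------------------------------------------------------
-- ℤ[y][[x]]; the value at n is the coefficient of x^n

Series : Set
Series = ℕ → Poly

module PowerSeries where

  infix  4 _≈_ _≈_/_
  infixl 6 _+_ _-_
  infixl 7 _*_
  infixr 8 _^_
  infix  9 #_

  _≈_ : Series → Series → Set
  F ≈ G = ∀ n → F n ≈ₚ G n

  #_ : ℕ → Series
  (# a) zero    = + a ∷ []
  (# a) (suc _) = []

  X : Series
  X 1 = + 1 ∷ []
  X _ = []

  Y : Series
  Y zero    = y^ 1
  Y (suc _) = []

  _+_ _-_ _*_ : Series → Series → Series
  (F + G) n = F n +ₚ G n
  (F - G) n = F n +ₚ (-ₚ G n)
  (F * G) n = sumₚ (map (λ i → F i *ₚ G (n ∸ i)) (upTo (suc n)))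

  _^_ : Series → ℕ → Series
  F ^ zero  = # 1
  F ^ suc m = F * F ^ m

  -- F = P / Q, that is: Q is invertible and F = P Q⁻¹.
  _≈_/_ : Series → Series → Series → Set
  F ≈ P / Q = ∃ λ Q⁻¹ → (Q * Q⁻¹ ≈ # 1) × (F ≈ P * Q⁻¹)

  -- F(x, a), a power series in x alone
  _[y≔_] : Series → ℤ → (ℕ → ℤ)
  (F [y≔ a ]) n = eval (F n) a

open PowerSeries using (_≈_/_; _[y≔_]) public

T : ℕ → Series
T k zero      = []
T k n@(suc _) = sumₚ (map (λ t → y^ ρ t) (𝒯 k (U-finite n)))

module _ (κ : ℕ) where
  open PowerSeries

  private
    k = # κ
    x = X
    y = Y

  p : Series
  p = k * x * y *
    ( # 1 - (# 1 - k) * y * (# 3 - (# 2 - k) * y)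
    - x * (# 1 - y) *
        ( # 4 - y * (# 13 - # 5 * k) + (# 3 + k) * (# 3 - # 2 * k) * y ^ 2
        - (# 1 - k) * (# 1 + (# 3 - k) * k) * y ^ 3 )
    + x ^ 2 * (# 1 - y) ^ 2 *
        ( # 3 - (# 2 + # 4 * k) * y + (# 1 - k + # 3 * k ^ 2) * y ^ 2
        + k ^ 2 * (# 1 - k) * y ^ 3 ) )

  q : Series
  q = # 1 - x *
    ( # 5 - # 12 * (# 2 - k) * y
    + x ^ 2 * (# 1 - y) ^ 2 *
        ( # 3 - (# 2 + # 4 * k) * y + k * (# 1 + # 2 * k) * y ^ 2
        + k * (# 1 - k) * y ^ 3 - (k - # 1) ^ 4 * y ^ 4 )
    - x * (# 1 - y) *
        ( # 7 - (# 25 - # 8 * k) * y + (# 20 - # 3 * k - # 4 * k ^ 2) * y ^ 2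
        + (# 5 - # 24 * k + # 21 * k ^ 2 - # 5 * k ^ 3) * y ^ 3
        - (# 7 - # 18 * k + # 17 * k ^ 2 - # 7 * k ^ 3 + k ^ 4) * y ^ 4 )
    + y ^ 2 *
        ( # 32 - # 26 * k + # 6 * k ^ 2
        - (# 13 - # 14 * k + # 6 * k ^ 2 - k ^ 3) * y ) )

{-# OPTIONS --safe #-}
module Submission where

-- A colored partition is the same thing as a coloring of the vertices: its
-- blocks are the monochromatic components.  Since K₃ is complete, every color
-- has at most one component meeting the first column of K₃ × Pₙ.  Hence putting
-- a column d in front of a column a creates one block for each color of d which
-- does not occur at the same height in a, and never merges two blocks.
--
-- So the partitions are counted by a transfer matrix indexed by columns.  By
-- symmetry the partial sums only depend on the number (1, 2 or 3) of colors of
-- the first column, which leaves a 3 × 3 matrix M over ℤ[k, y].  The theorem is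
-- Cramer's rule for 1 − x M: q is its determinant.  At y = 1 one counts all the
-- colorings.

open import Defs
open import Algebra.Bundles using (CommutativeRing; RawRing)
import Algebra.Construct.Pointwise as Pointwise
open import Algebra.Core using (Op₂)
import Algebra.Morphism.RingMonomorphism as RingMonomorphism
open import Algebra.Morphism.Structures using (IsRingMonomorphism)
import Algebra.Solver.Ring
open import Algebra.Solver.Ring.AlmostCommutativeRing using (_-Raw-AlmostCommutative⟶_; fromCommutativeRing)
open import Data.Bool using (if_then_else_)
import Data.Bool as Bool using (T)
open import Data.Empty using (⊥)
import Data.Fin as Fin using (_↑ˡ_)
open import Data.Fin using (#_; Fin; suc; zero)
import Data.Fin.Properties as Fin
import Data.Integer as ℤ
open import Data.Integer using (+_; -[1+_]; ℤ)
import Data.Integer.Properties as ℤ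
import Data.List as List
open import Data.List using (List; []; _++_; _∷_; allFin; applyUpTo; cartesianProductWith; filter; foldr; length; map)
open import Data.List.Membership.Propositional using (_∈_; find)
open import Data.List.Membership.Propositional.Properties using (∈-++⁺ʳ; ∈-++⁺ˡ; ∈-++⁻; ∈-allFin; ∈-cartesianProductWith⁺; ∈-filter⁺; ∈-filter⁻; ∈-lookup; ∈-map⁺; ∈-map⁻)
open import Data.List.Membership.Propositional.Properties.WithK using (unique∧set⇒bag)
open import Data.List.Properties using (length-++; length-map; length-tabulate; map-applyUpTo; map-∘)
open import Data.List.Relation.Binary.BagAndSetEquality using (∼bag⇒↭)
import Data.List.Relation.Binary.Permutation.Propositional as ↭
open import Data.List.Relation.Binary.Permutation.Propositional using (_↭_; prep; swap)
open import Data.List.Relation.Binary.Permutation.Propositional.Properties using (↭-length)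
open import Data.List.Relation.Unary.All as All using (All; []; _∷_)
open import Data.List.Relation.Unary.AllPairs using ([]; _∷_)
open import Data.List.Relation.Unary.Any using (here; index)
open import Data.List.Relation.Unary.Any.Properties using (lookup-index)
open import Data.List.Relation.Unary.Unique.Propositional using (Unique)
import Data.List.Relation.Unary.Unique.Propositional.Properties as Unique
import Data.List.Relation.Unary.Unique.Setoid.Properties as SetoidUnique
import Data.Maybe as Maybe
open import Data.Maybe using (Maybe; is-just; just; nothing)
import Data.Nat as ℕ
open import Data.Nat using (_∸_; _≤_; suc; s≤s; zero; z≤n; ℕ)
import Data.Nat.Properties as ℕ
open import Data.Product using (_,_; _×_; proj₁; proj₂; ∃)
open import Data.Sum using (inj₁; inj₂)
import Data.Vec as Vec
open import Data.Vec using (Vec; []; _∷_; lookup; replicate; tabulate)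
import Data.Vec.Properties as Vec
open import Function using (Equivalence; _⇔_; _∘_; mk⇔)
open import Function.Definitions using (Injective)
open import Level using (0ℓ)
open import Relation.Binary.Construct.Closure.ReflexiveTransitive using (Star; _◅_; _◅◅_; gmap; reverse; ε)
open import Relation.Binary.PropositionalEquality using (_≡_; _≢_; cong; cong₂; refl; subst; sym; trans)
import Relation.Binary.PropositionalEquality as ≡
import Relation.Binary.Reasoning.Setoid as ≈-Reasoning
open import Relation.Nullary using (Dec; _×-dec_; contradiction; does; no; yes; ¬?; ¬_)
open import Relation.Unary using (Decidable; Pred)

-- Power series and polynomials

-- The obstacle is that k is a variable, so a sum over all k³ columns cannot be expanded. It is
-- evaluated on color patterns instead. If m colors are already named, a new letter is one of these
-- m, or one of the k - m others, which all give the same result because block counts only test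
-- colors for equality. A sum over columns thus becomes an expression of bounded size in k and y,
-- valid for every k: a pattern with more than k colors carries a factor k - k = 0. The same
-- recursion is run on values and on syntax, so that the ring normaliser can compare its outcome
-- with the matrix entries.
--
-- Summing out the columns from the front gives T = x f (1 + x M + x² M² + ...) e, where f lists the
-- weights of a single column by its number of colors and e is the vector of ones. The series v with
-- coefficients M^n e solves (1 - x M) v = e. Multiplying by the row x f adj(1 - x M) yields q T = p
-- without any division, and q is invertible since its constant term in x is 1.

module FormalPowerSeries {c ℓ} (R : CommutativeRing c ℓ) where
  open CommutativeRing R hiding (zero; refl; sym; trans)
  private module R = CommutativeRing R
  open ≈-Reasoning setoid
  open import Algebra.Properties.CommutativeSemigroup +-commutativeSemigroup using (interchange; x∙yz≈y∙xz)

  Coefficients : Set c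
  Coefficients = ℕ → Carrier

  infix 4 _≋_
  _≋_ : Coefficients → Coefficients → Set ℓ
  F ≋ G = ∀ n → F n ≈ G n

  infixl 7 _⊛_
  -- The Cauchy product, by recursion along F = F 0 + x (F ∘ suc), so that the ring laws become
  -- inductions on the degree. `convolution` identifies it with the sum over i of F i G (n - i).
  _⊛_ : Coefficients → Coefficients → Coefficients
  (F ⊛ G) zero    = F 0 * G 0
  (F ⊛ G) (suc n) = F 0 * G (suc n) + (F ∘ suc ⊛ G) n

  constant : Carrier → Coefficients
  constant a zero    = a
  constant a (suc _) = 0#

  ⊛-cong : ∀ {F F′ G G′} → F ≋ F′ → G ≋ G′ → F ⊛ G ≋ F′ ⊛ G′
  ⊛-cong f g zero    = *-cong (f 0) (g 0)
  ⊛-cong f g (suc n) = +-cong (*-cong (f 0) (g (suc n))) (⊛-cong (f ∘ suc) g n)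

  ⊛-zeroˡ : ∀ {F} G → (∀ n → F n ≈ 0#) → ∀ n → (F ⊛ G) n ≈ 0#
  ⊛-zeroˡ G f zero    = R.trans (*-congʳ (f 0)) (zeroˡ _)
  ⊛-zeroˡ {F} G f (suc n) = begin
    F 0 * G (suc n) + (F ∘ suc ⊛ G) n ≈⟨ +-cong (*-congʳ (f 0)) (⊛-zeroˡ G (f ∘ suc) n) ⟩
    0# * G (suc n) + 0#               ≈⟨ +-congʳ (zeroˡ _) ⟩
    0# + 0#                           ≈⟨ +-identityˡ _ ⟩
    0#                                ∎

  constant-⊛ : ∀ a G n → (constant a ⊛ G) n ≈ a * G n
  constant-⊛ a G zero    = R.refl
  constant-⊛ a G (suc n) = begin
    a * G (suc n) + ((λ _ → 0#) ⊛ G) n ≈⟨ +-congˡ (⊛-zeroˡ G (λ _ → R.refl) n) ⟩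
    a * G (suc n) + 0#                 ≈⟨ +-identityʳ _ ⟩
    a * G (suc n)                      ∎

  ⊛-distribʳ : ∀ H F G n → ((λ i → F i + G i) ⊛ H) n ≈ (F ⊛ H) n + (G ⊛ H) n
  ⊛-distribʳ H F G zero    = distribʳ _ _ _
  ⊛-distribʳ H F G (suc n) = begin
    (F 0 + G 0) * H (suc n) + ((λ i → F (suc i) + G (suc i)) ⊛ H) n
      ≈⟨ +-cong (distribʳ _ _ _) (⊛-distribʳ H (F ∘ suc) (G ∘ suc) n) ⟩
    (F 0 * H (suc n) + G 0 * H (suc n)) + ((F ∘ suc ⊛ H) n + (G ∘ suc ⊛ H) n)
      ≈⟨ interchange _ _ _ _ ⟩
    (F ⊛ H) (suc n) + (G ⊛ H) (suc n) ∎

  -- The mirror image of the defining recursion, splitting the right factor; commutativity rests on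
  -- it.
  ⊛-sucʳ : ∀ F G n → (F ⊛ G) (suc n) ≈ F (suc n) * G 0 + (F ⊛ G ∘ suc) n
  ⊛-sucʳ F G zero    = +-comm _ _
  ⊛-sucʳ F G (suc n) = begin
    F 0 * G (suc (suc n)) + (F ∘ suc ⊛ G) (suc n)
      ≈⟨ +-congˡ (⊛-sucʳ (F ∘ suc) G n) ⟩
    F 0 * G (suc (suc n)) + (F (suc (suc n)) * G 0 + (F ∘ suc ⊛ G ∘ suc) n)
      ≈⟨ x∙yz≈y∙xz _ _ _ ⟩
    F (suc (suc n)) * G 0 + (F ⊛ G ∘ suc) (suc n) ∎

  ⊛-comm : ∀ F G → F ⊛ G ≋ G ⊛ F
  ⊛-comm F G zero    = *-comm _ _
  ⊛-comm F G (suc n) = begin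
    F 0 * G (suc n) + (F ∘ suc ⊛ G) n ≈⟨ +-cong (*-comm _ _) (⊛-comm (F ∘ suc) G n) ⟩
    G (suc n) * F 0 + (G ⊛ F ∘ suc) n ≈⟨ ⊛-sucʳ G F n ⟨
    (G ⊛ F) (suc n)                   ∎

  scale-⊛ : ∀ a F G n → ((λ i → a * F i) ⊛ G) n ≈ a * (F ⊛ G) n
  scale-⊛ a F G zero    = *-assoc _ _ _
  scale-⊛ a F G (suc n) = begin
    a * F 0 * G (suc n) + ((λ i → a * F (suc i)) ⊛ G) n ≈⟨ +-cong (*-assoc _ _ _) (scale-⊛ a (F ∘ suc) G n) ⟩
    a * (F 0 * G (suc n)) + a * (F ∘ suc ⊛ G) n         ≈⟨ distribˡ _ _ _ ⟨
    a * (F ⊛ G) (suc n)                                 ∎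

  ⊛-assoc : ∀ F G H → (F ⊛ G) ⊛ H ≋ F ⊛ (G ⊛ H)
  ⊛-assoc F G H zero    = *-assoc _ _ _
  ⊛-assoc F G H (suc n) = begin
    F 0 * G 0 * H (suc n) + ((λ i → F 0 * G (suc i) + (F ∘ suc ⊛ G) i) ⊛ H) n
      ≈⟨ +-cong (*-assoc _ _ _) (⊛-distribʳ H (λ i → F 0 * G (suc i)) (F ∘ suc ⊛ G) n) ⟩
    F 0 * (G 0 * H (suc n)) + (((λ i → F 0 * G (suc i)) ⊛ H) n + ((F ∘ suc ⊛ G) ⊛ H) n)
      ≈⟨ +-congˡ (+-cong (scale-⊛ (F 0) (G ∘ suc) H n) (⊛-assoc (F ∘ suc) G H n)) ⟩
    F 0 * (G 0 * H (suc n)) + (F 0 * (G ∘ suc ⊛ H) n + (F ∘ suc ⊛ (G ⊛ H)) n)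
      ≈⟨ +-assoc _ _ _ ⟨
    F 0 * (G 0 * H (suc n)) + F 0 * (G ∘ suc ⊛ H) n + (F ∘ suc ⊛ (G ⊛ H)) n
      ≈⟨ +-congʳ (distribˡ _ _ _) ⟨
    (F ⊛ (G ⊛ H)) (suc n) ∎

  ⊛-identityˡ : ∀ F → constant 1# ⊛ F ≋ F
  ⊛-identityˡ F n = R.trans (constant-⊛ 1# F n) (*-identityˡ _)

  commutativeRing : CommutativeRing c ℓ
  commutativeRing = record
    { Carrier = Coefficients
    ; _≈_ = _≋_
    ; _+_ = λ F G n → F n + G n
    ; _*_ = _⊛_
    ; -_  = λ F n → - F n
    ; 0#  = λ _ → 0#
    ; 1#  = constant 1#
    ; isCommutativeRing = record
      { isRing = record
        { +-isAbelianGroup = Pointwise.isAbelianGroup ℕ +-isAbelianGroup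
        ; *-cong     = ⊛-cong
        ; *-assoc    = ⊛-assoc
        ; *-identity = ⊛-identityˡ , λ F n → R.trans (⊛-comm F (constant 1#) n) (⊛-identityˡ F n)
        ; distrib    = (λ F G H n → R.trans (⊛-comm F _ n) (R.trans (⊛-distribʳ F G H n)
                         (+-cong (⊛-comm G F n) (⊛-comm H F n)))) , ⊛-distribʳ
        }
      ; *-comm = ⊛-comm
      }
    }

  convolution : ∀ F G n →
    foldr _+_ 0# (applyUpTo (λ i → F i * G (n ∸ i)) (suc n)) ≈ (F ⊛ G) n
  convolution F G zero    = +-identityʳ _
  convolution F G (suc n) = +-congˡ (convolution (F ∘ suc) G n)

  -- Convergence of the iteration below: a coefficient of a product sees no higher degree of its
  -- factors, so after the shift by x each round gains one correct coefficient.
  ⊛-local : ∀ H {F G} n → (∀ i → i ≤ n → F i ≈ G i) → (H ⊛ F) n ≈ (H ⊛ G) n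
  ⊛-local H zero    e = *-congˡ (e 0 z≤n)
  ⊛-local H (suc n) e = +-cong (*-congˡ (e (suc n) ℕ.≤-refl))
    (⊛-local (H ∘ suc) n (λ i i≤n → e i (ℕ.m≤n⇒m≤1+n i≤n)))

  -- The fixed point of F = 1 + x H F, that is 1 / (1 − x H): the m-th iterate
  -- is correct up to degree m.
  iterate : Coefficients → ℕ → Coefficients
  iterate H zero    i       = constant 1# i
  iterate H (suc m) zero    = 1#
  iterate H (suc m) (suc i) = (H ⊛ iterate H m) i

  geometric : Coefficients → Coefficients
  geometric H n = iterate H n n

  iterate-stable : ∀ H m i → i ≤ m → iterate H (suc m) i ≈ iterate H m i
  iterate-stable H zero    zero    _         = R.refl
  iterate-stable H (suc m) zero    _         = R.refl
  iterate-stable H (suc m) (suc i) (s≤s i≤m) =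
    ⊛-local H i (λ j j≤i → iterate-stable H m j (ℕ.≤-trans j≤i i≤m))

  iterate≈geometric : ∀ H m i → i ≤ m → iterate H m i ≈ geometric H i
  iterate≈geometric H zero    zero z≤n = R.refl
  iterate≈geometric H (suc m) i    i≤  with ℕ.m≤n⇒m<n∨m≡n i≤
  ... | inj₁ (s≤s i≤m) = R.trans (iterate-stable H m i i≤m) (iterate≈geometric H m i i≤m)
  ... | inj₂ refl      = R.refl

  geometric-suc : ∀ H n → geometric H (suc n) ≈ (H ⊛ geometric H) n
  geometric-suc H n = ⊛-local H n (iterate≈geometric H n)

-- The rings ℤ[y] and ℤ[y][[x]]

module ℤ⟦y⟧ = FormalPowerSeries ℤ.+-*-commutativeRing

coeff-+ : ∀ f g i → coeff (f +ₚ g) i ≡ coeff f i ℤ.+ coeff g i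
coeff-+ []      g       i       = sym (ℤ.+-identityˡ _)
coeff-+ (a ∷ f) []      i       = sym (ℤ.+-identityʳ _)
coeff-+ (a ∷ f) (b ∷ g) zero    = refl
coeff-+ (a ∷ f) (b ∷ g) (suc i) = coeff-+ f g i

coeff-map : ∀ {h} → h (+ 0) ≡ + 0 → ∀ f i → coeff (map h f) i ≡ h (coeff f i)
coeff-map h0 []      i       = sym h0
coeff-map h0 (a ∷ f) zero    = refl
coeff-map h0 (a ∷ f) (suc i) = coeff-map h0 f i

coeff-* : ∀ f g i → coeff (f *ₚ g) i ≡ (coeff f ℤ⟦y⟧.⊛ coeff g) i
coeff-* []      g i = sym (ℤ⟦y⟧.⊛-zeroˡ (coeff g) (λ _ → refl) i)
coeff-* (a ∷ f) g zero =
  trans (coeff-+ (map (a ℤ.*_) g) (+ 0 ∷ f *ₚ g) 0)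
        (trans (ℤ.+-identityʳ _) (coeff-map (ℤ.*-zeroʳ a) g 0))
coeff-* (a ∷ f) g (suc i) =
  trans (coeff-+ (map (a ℤ.*_) g) (+ 0 ∷ f *ₚ g) (suc i))
        (cong₂ ℤ._+_ (coeff-map (ℤ.*-zeroʳ a) g (suc i)) (coeff-* f g i))

coeff-constant : ∀ a i → coeff (a ∷ []) i ≡ ℤ⟦y⟧.constant a i
coeff-constant a zero    = refl
coeff-constant a (suc i) = refl

-- Unlike _≈ₚ_ and PowerSeries._≈_, which unfold to equations between integers,
-- these relations determine the polynomials and the series they compare.
infix 4 _≃ₚ_ _≃ₛ_
record _≃ₚ_ (f g : Poly) : Set where
  constructor coeffwise
  field coefficient : f ≈ₚ g

record _≃ₛ_ (F G : Series) : Set where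
  constructor termwise
  field term : ∀ n → F n ≃ₚ G n

open _≃ₚ_
open _≃ₛ_

Poly-rawRing : RawRing 0ℓ 0ℓ
Poly-rawRing = record
  { Carrier = Poly ; _≈_ = _≃ₚ_ ; _+_ = _+ₚ_ ; _*_ = _*ₚ_ ; -_ = -ₚ_ ; 0# = [] ; 1# = + 1 ∷ [] }

-- Coefficient lists are awkward to compute with because of trailing zeros. Their ring laws are
-- pulled back from ℤ[[y]] along the injection `coeff`.
coeff-isRingMonomorphism :
  IsRingMonomorphism Poly-rawRing (CommutativeRing.rawRing ℤ⟦y⟧.commutativeRing) coeff
coeff-isRingMonomorphism = record
  { isRingHomomorphism = record
    { isSemiringHomomorphism = record
      { isNearSemiringHomomorphism = record
        { +-isMonoidHomomorphism = record
          { isMagmaHomomorphism = record { isRelHomomorphism = record { cong = coefficient } ; homo = coeff-+ }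
          ; ε-homo = λ _ → refl
          }
        ; *-homo = coeff-*
        }
      ; 1#-homo = coeff-constant (+ 1)
      }
    ; -‿homo = coeff-map refl
    }
  ; injective = coeffwise
  }

Poly-commutativeRing : CommutativeRing 0ℓ 0ℓ
Poly-commutativeRing = record
  { isCommutativeRing = RingMonomorphism.isCommutativeRing coeff-isRingMonomorphism
      (CommutativeRing.isCommutativeRing ℤ⟦y⟧.commutativeRing) }

private module P = CommutativeRing Poly-commutativeRing
module ℤ[y]⟦x⟧ = FormalPowerSeries Poly-commutativeRing

Series-rawRing : RawRing 0ℓ 0ℓ
Series-rawRing = record
  { Carrier = Series ; _≈_ = _≃ₛ_ ; _+_ = _+_ ; _*_ = _*_ ; -_ = λ F n → -ₚ F n ; 0# = λ _ → [] ; 1# = PowerSeries.# 1 }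
  where open PowerSeries using (_+_; _*_)

*≈⊛ : ∀ F G n → (F PowerSeries.* G) n ≃ₚ (F ℤ[y]⟦x⟧.⊛ G) n
*≈⊛ F G n = subst (_≃ₚ (F ℤ[y]⟦x⟧.⊛ G) n)
  (cong sumₚ (sym (map-applyUpTo (λ i → i) (λ i → F i *ₚ G (n ∸ i)) (suc n))))
  (ℤ[y]⟦x⟧.convolution F G n)

#≈constant : ∀ a n → (PowerSeries.# a) n ≃ₚ ℤ[y]⟦x⟧.constant (+ a ∷ []) n
#≈constant a zero    = P.refl
#≈constant a (suc n) = P.refl

-- The product of the statement agrees termwise with `⊛`, so the ring laws are transported along the
-- identity map.
Series-commutativeRing : CommutativeRing 0ℓ 0ℓ
Series-commutativeRing = record
  { isCommutativeRing = RingMonomorphism.isCommutativeRing id-isRingMonomorphism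
      (CommutativeRing.isCommutativeRing ℤ[y]⟦x⟧.commutativeRing) }
  where
  id-isRingMonomorphism :
    IsRingMonomorphism Series-rawRing (CommutativeRing.rawRing ℤ[y]⟦x⟧.commutativeRing) (λ F → F)
  id-isRingMonomorphism = record
    { isRingHomomorphism = record
      { isSemiringHomomorphism = record
        { isNearSemiringHomomorphism = record
          { +-isMonoidHomomorphism = record
            { isMagmaHomomorphism = record
              { isRelHomomorphism = record { cong = term } ; homo = λ _ _ _ → P.refl }
            ; ε-homo = λ _ → P.refl
            }
          ; *-homo = *≈⊛
          }
        ; 1#-homo = #≈constant 1
        }
      ; -‿homo = λ _ _ → P.refl
      }
    ; injective = termwise
    }

private module S = CommutativeRing Series-commutativeRing

-- Polynomial identities and finite sums

unique∧set⇒↭ : ∀ {A : Set} {xs ys : List A} → Unique xs → Unique ys →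
               (∀ {v} → v ∈ xs → v ∈ ys) → (∀ {v} → v ∈ ys → v ∈ xs) → xs ↭ ys
unique∧set⇒↭ u v f g = ∼bag⇒↭ (unique∧set⇒bag u v (mk⇔ f g))

infixl 6 _⊕_
infixl 7 _⊗_
infixr 8 _↑_
infix  9 ⊝_

-- One syntax for two evaluations, in ℤ[y] and in ℤ[y][[x]], and a target on which `chooseColumn`
-- can be run. `∅` is kept apart from `con (+ 0)` so that a `foldr` ending in `0#` is the value of
-- an expression by computation.
data Expr (n : ℕ) : Set where
  ∅       : Expr n
  con     : ℤ → Expr n
  var     : Fin n → Expr n
  _⊕_ _⊗_ : Expr n → Expr n → Expr n
  ⊝_      : Expr n → Expr n

_↑_ : ∀ {n} → Expr n → ℕ → Expr n
e ↑ zero  = con (+ 1)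
e ↑ suc m = e ⊗ e ↑ m

rename : ∀ {m n} → (Fin m → Fin n) → Expr m → Expr n
rename σ ∅       = ∅
rename σ (con a) = con a
rename σ (var i) = var (σ i)
rename σ (e ⊕ f) = rename σ e ⊕ rename σ f
rename σ (e ⊗ f) = rename σ e ⊗ rename σ f
rename σ (⊝ e)   = ⊝ rename σ e

IntegerCoefficients : CommutativeRing 0ℓ 0ℓ → Set
IntegerCoefficients R = ℤ.+-*-rawRing -Raw-AlmostCommutative⟶ fromCommutativeRing R

module Evaluation (R : CommutativeRing 0ℓ 0ℓ) (φ : IntegerCoefficients R) where
  open CommutativeRing R using (Carrier; _≈_; _+_; _*_; -_; 0#; +-cong; *-cong; -‿cong; setoid)
  open _-Raw-AlmostCommutative⟶_ φ using () renaming (⟦_⟧ to fromℤ)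

  ⟦_⟧ : ∀ {n} → Expr n → Vec Carrier n → Carrier
  ⟦ ∅ ⟧     ρ = 0#
  ⟦ con a ⟧ ρ = fromℤ a
  ⟦ var i ⟧ ρ = lookup ρ i
  ⟦ e ⊕ f ⟧ ρ = ⟦ e ⟧ ρ + ⟦ f ⟧ ρ
  ⟦ e ⊗ f ⟧ ρ = ⟦ e ⟧ ρ * ⟦ f ⟧ ρ
  ⟦ ⊝ e ⟧   ρ = - ⟦ e ⟧ ρ

  ⟦⟧-rename-↑ˡ : ∀ {m n} (e : Expr m) (ρ : Vec Carrier m) (σ : Vec Carrier n) →
                 ⟦ rename (Fin._↑ˡ n) e ⟧ (ρ Vec.++ σ) ≡ ⟦ e ⟧ ρ
  ⟦⟧-rename-↑ˡ ∅       ρ σ = refl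
  ⟦⟧-rename-↑ˡ (con a) ρ σ = refl
  ⟦⟧-rename-↑ˡ (var i) ρ σ = Vec.lookup-++ˡ ρ σ i
  ⟦⟧-rename-↑ˡ (e ⊕ f) ρ σ = cong₂ _+_ (⟦⟧-rename-↑ˡ e ρ σ) (⟦⟧-rename-↑ˡ f ρ σ)
  ⟦⟧-rename-↑ˡ (e ⊗ f) ρ σ = cong₂ _*_ (⟦⟧-rename-↑ˡ e ρ σ) (⟦⟧-rename-↑ˡ f ρ σ)
  ⟦⟧-rename-↑ˡ (⊝ e)   ρ σ = cong -_ (⟦⟧-rename-↑ˡ e ρ σ)

  private
    _≟_ : (a b : ℤ) → Maybe (CommutativeRing._≈_ R (fromℤ a) (fromℤ b))
    a ≟ b with a ℤ.≟ b
    ... | yes a≡b = just (CommutativeRing.reflexive R (cong fromℤ a≡b))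
    ... | no _    = nothing

    module Solver = Algebra.Solver.Ring ℤ.+-*-rawRing (fromCommutativeRing R) φ _≟_

  polynomial : ∀ {n} → Expr n → Solver.Polynomial n
  polynomial ∅       = Solver.con (+ 0)
  polynomial (con a) = Solver.con a
  polynomial (var i) = Solver.var i
  polynomial (e ⊕ f) = polynomial e Solver.:+ polynomial f
  polynomial (e ⊗ f) = polynomial e Solver.:* polynomial f
  polynomial (⊝ e)   = Solver.:- polynomial e

  polynomial-correct : ∀ {n} (e : Expr n) ρ → Solver.⟦ polynomial e ⟧ ρ ≈ ⟦ e ⟧ ρ
  polynomial-correct ∅       ρ = _-Raw-AlmostCommutative⟶_.0-homo φ
  polynomial-correct (con a) ρ = CommutativeRing.refl R
  polynomial-correct (var i) ρ = CommutativeRing.refl R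
  polynomial-correct (e ⊕ f) ρ = +-cong (polynomial-correct e ρ) (polynomial-correct f ρ)
  polynomial-correct (e ⊗ f) ρ = *-cong (polynomial-correct e ρ) (polynomial-correct f ρ)
  polynomial-correct (⊝ e)   ρ = -‿cong (polynomial-correct e ρ)

  infix 4 _≟ₙ_
  _≟ₙ_ : ∀ {n} (e f : Expr n) → Maybe (Solver.normalise (polynomial e) Solver.≈N Solver.normalise (polynomial f))
  e ≟ₙ f = Solver.normalise (polynomial e) Solver.≟N Solver.normalise (polynomial f)

  -- Unlike `solve`, this compares the normal forms themselves rather than their
  -- values, so that type checking never unfolds the operations of R.
  identity : ∀ {n} (e f : Expr n) → Bool.T (is-just (e ≟ₙ f)) → ∀ ρ → ⟦ e ⟧ ρ ≈ ⟦ f ⟧ ρ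
  identity e f _ ρ with e ≟ₙ f
  ... | just eq = begin
    ⟦ e ⟧ ρ                ≈⟨ polynomial-correct e ρ ⟨
    Solver.⟦ polynomial e ⟧ ρ   ≈⟨ Solver.correct (polynomial e) ρ ⟨
    Solver.⟦ polynomial e ⟧↓ ρ  ≈⟨ Solver.⟦ eq ⟧N-cong ρ ⟩
    Solver.⟦ polynomial f ⟧↓ ρ  ≈⟨ Solver.correct (polynomial f) ρ ⟩
    Solver.⟦ polynomial f ⟧ ρ   ≈⟨ polynomial-correct f ρ ⟩
    ⟦ f ⟧ ρ                ∎
    where open ≈-Reasoning setoid

module FiniteSums (R : CommutativeRing 0ℓ 0ℓ) (φ : IntegerCoefficients R) where
  open CommutativeRing R hiding (zero; refl; sym; trans)
  private module R = CommutativeRing R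
  open _-Raw-AlmostCommutative⟶_ φ renaming (⟦_⟧ to fromℤ)
  open import Algebra.Properties.CommutativeSemigroup +-commutativeSemigroup using (interchange; x∙yz≈y∙xz)
  open ≈-Reasoning setoid

  infixr 8 _^_
  -- The base case is `fromℤ (+ 1)` rather than `1#`, in agreement with the value of `_↑_`.
  _^_ : Carrier → ℕ → Carrier
  a ^ zero  = fromℤ (+ 1)
  a ^ suc n = a * a ^ n

  ^-+ : ∀ a i j → a ^ (i ℕ.+ j) ≈ a ^ i * a ^ j
  ^-+ a zero    j = R.sym (R.trans (*-congʳ 1-homo) (*-identityˡ _))
  ^-+ a (suc i) j = R.trans (*-congˡ (^-+ a i j)) (R.sym (*-assoc _ _ _))

  ∑ : ∀ {A : Set} → List A → (A → Carrier) → Carrier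
  ∑ xs f = foldr _+_ 0# (map f xs)

  module _ {A : Set} where

    ∑-cong : ∀ (xs : List A) {f g} → (∀ x → f x ≈ g x) → ∑ xs f ≈ ∑ xs g
    ∑-cong []       e = R.refl
    ∑-cong (x ∷ xs) e = +-cong (e x) (∑-cong xs e)

    ∑-congAll : ∀ {xs : List A} {f g} → All (λ x → f x ≈ g x) xs → ∑ xs f ≈ ∑ xs g
    ∑-congAll []       = R.refl
    ∑-congAll (e ∷ es) = +-cong e (∑-congAll es)

    ∑-zero : ∀ (xs : List A) → ∑ xs (λ _ → 0#) ≈ 0#
    ∑-zero []       = R.refl
    ∑-zero (x ∷ xs) = R.trans (+-identityˡ _) (∑-zero xs)

    ∑-+ : ∀ (xs : List A) f g → ∑ xs (λ x → f x + g x) ≈ ∑ xs f + ∑ xs g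
    ∑-+ []       f g = R.sym (+-identityˡ _)
    ∑-+ (x ∷ xs) f g = R.trans (+-congˡ (∑-+ xs f g)) (interchange _ _ _ _)

    ∑-*ˡ : ∀ (xs : List A) a f → ∑ xs (λ x → a * f x) ≈ a * ∑ xs f
    ∑-*ˡ []       a f = R.sym (zeroʳ _)
    ∑-*ˡ (x ∷ xs) a f = R.trans (+-congˡ (∑-*ˡ xs a f)) (R.sym (distribˡ _ _ _))

    ∑-const : ∀ (xs : List A) a → ∑ xs (λ _ → a) ≈ fromℤ (+ length xs) * a
    ∑-const []       a = R.sym (R.trans (*-congʳ 0-homo) (zeroˡ _))
    ∑-const (x ∷ xs) a = begin
      a + ∑ xs (λ _ → a)                        ≈⟨ +-cong (*-identityˡ a) (R.sym (∑-const xs a)) ⟨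
      1# * a + fromℤ (+ length xs) * a          ≈⟨ distribʳ _ _ _ ⟨
      (1# + fromℤ (+ length xs)) * a            ≈⟨ *-congʳ (+-congʳ 1-homo) ⟨
      (fromℤ (+ 1) + fromℤ (+ length xs)) * a   ≈⟨ *-congʳ (+-homo (+ 1) (+ length xs)) ⟨
      fromℤ (+ length (x ∷ xs)) * a             ∎

    ∑-++ : ∀ (xs ys : List A) f → ∑ (xs ++ ys) f ≈ ∑ xs f + ∑ ys f
    ∑-++ []       ys f = R.sym (+-identityˡ _)
    ∑-++ (x ∷ xs) ys f = R.trans (+-congˡ (∑-++ xs ys f)) (R.sym (+-assoc _ _ _))

    ∑-↭ : ∀ {xs ys : List A} f → xs ↭ ys → ∑ xs f ≈ ∑ ys f
    ∑-↭ f ↭.refl        = R.refl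
    ∑-↭ f (prep x p)    = +-congˡ (∑-↭ f p)
    ∑-↭ f (swap x y p)  = R.trans (+-congˡ (+-congˡ (∑-↭ f p))) (x∙yz≈y∙xz _ _ _)
    ∑-↭ f (↭.trans p q) = R.trans (∑-↭ f p) (∑-↭ f q)

    ∑-map : ∀ {B : Set} (g : B → A) xs f → ∑ (map g xs) f ≈ ∑ xs (f ∘ g)
    ∑-map g xs f = R.reflexive (cong (foldr _+_ 0#) (sym (map-∘ xs)))

  ∑-product : ∀ {A B C : Set} (g : A → B → C) xs ys f →
              ∑ (cartesianProductWith g xs ys) f ≈ ∑ xs (λ x → ∑ ys (λ y → f (g x y)))
  ∑-product g []       ys f = R.refl
  ∑-product g (x ∷ xs) ys f = R.trans (∑-++ (map (g x) ys) _ f)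
    (+-cong (∑-map (g x) ys f) (∑-product g xs ys f))

  ∑-comm : ∀ {A B : Set} (xs : List A) (ys : List B) (f : A → B → Carrier) →
           ∑ xs (λ x → ∑ ys (λ y → f x y)) ≈ ∑ ys (λ y → ∑ xs (λ x → f x y))
  ∑-comm []       ys f = R.sym (∑-zero ys)
  ∑-comm (x ∷ xs) ys f = R.trans (+-congˡ (∑-comm xs ys f)) (R.sym (∑-+ ys _ _))

  -- Each of the n - m points outside the image of `ρ` contributes `r`. Their number is expressed as
  -- a difference in the ring, which makes it a polynomial coefficient.
  ∑-Fin-split : ∀ {m n} (ρ : Fin m → Fin n) → Injective _≡_ _≡_ ρ → ∀ f r →
    (∀ x → (∀ i → ρ i ≢ x) → f x ≈ r) →
    ∑ (allFin n) f ≈ ∑ (allFin m) (f ∘ ρ) + (fromℤ (+ n) - fromℤ (+ m)) * r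
  ∑-Fin-split {m} {n} ρ inj f r out = begin
    ∑ (allFin n) f
      ≈⟨ ∑-↭ f allFin↭ ⟩
    ∑ (map ρ (allFin m) ++ rest) f
      ≈⟨ ∑-++ (map ρ (allFin m)) rest f ⟩
    ∑ (map ρ (allFin m)) f + ∑ rest f
      ≈⟨ +-cong (∑-map ρ (allFin m) f) (∑-congAll (All.tabulate λ x∈ → out _ (missed x∈))) ⟩
    ∑ (allFin m) (f ∘ ρ) + ∑ rest (λ _ → r)
      ≈⟨ +-congˡ (∑-const rest r) ⟩
    ∑ (allFin m) (f ∘ ρ) + fromℤ (+ length rest) * r
      ≈⟨ +-congˡ (*-congʳ count) ⟩
    ∑ (allFin m) (f ∘ ρ) + (fromℤ (+ n) - fromℤ (+ m)) * r ∎
    where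
    image? = λ x → Fin.any? (λ i → ρ i Fin.≟ x)
    rest = filter (¬? ∘ image?) (allFin n)

    missed : ∀ {x} → x ∈ rest → ∀ i → ρ i ≢ x
    missed x∈ i e = proj₂ (∈-filter⁻ (¬? ∘ image?) {xs = allFin n} x∈) (i , e)

    allFin↭ : allFin n ↭ map ρ (allFin m) ++ rest
    allFin↭ = unique∧set⇒↭ (Unique.allFin⁺ n)
      (Unique.++⁺ (Unique.map⁺ inj (Unique.allFin⁺ m)) (Unique.filter⁺ (¬? ∘ image?) (Unique.allFin⁺ n))
        λ { (x∈ , x∉) → let i , _ , e = ∈-map⁻ ρ x∈ in missed x∉ i (sym e) })
      to (λ _ → ∈-allFin _)
      where
      to : ∀ {x} → x ∈ allFin n → x ∈ map ρ (allFin m) ++ rest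
      to {x} x∈ with image? x
      ... | yes (i , refl) = ∈-++⁺ˡ (∈-map⁺ ρ (∈-allFin i))
      ... | no ¬i          = ∈-++⁺ʳ (map ρ (allFin m)) (∈-filter⁺ (¬? ∘ image?) x∈ ¬i)

    n≡m+rest : n ≡ m ℕ.+ length rest
    n≡m+rest = trans (sym (length-tabulate {n = n} (λ i → i))) (trans (↭-length allFin↭)
      (trans (length-++ (map ρ (allFin m))) (cong (ℕ._+ length rest)
        (trans (length-map ρ (allFin m)) (length-tabulate {n = m} (λ i → i))))))

    count : fromℤ (+ length rest) ≈ fromℤ (+ n) - fromℤ (+ m)
    count = begin
      fromℤ (+ length rest)                             ≈⟨ +-identityˡ _ ⟨
      0# + fromℤ (+ length rest)                        ≈⟨ +-congʳ (-‿inverseˡ _) ⟨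
      - fromℤ (+ m) + fromℤ (+ m) + fromℤ (+ length rest) ≈⟨ +-assoc _ _ _ ⟩
      - fromℤ (+ m) + (fromℤ (+ m) + fromℤ (+ length rest)) ≈⟨ +-congˡ (+-homo (+ m) (+ length rest)) ⟨
      - fromℤ (+ m) + fromℤ (+ (m ℕ.+ length rest))     ≈⟨ +-congˡ (R.reflexive (cong (fromℤ ∘ +_) n≡m+rest)) ⟨
      - fromℤ (+ m) + fromℤ (+ n)                       ≈⟨ +-comm _ _ ⟩
      fromℤ (+ n) - fromℤ (+ m)                         ∎

-- The transfer matrix

Column : ℕ → Set
Column k = Vec (Fin k) 3

-- `nothing` stands for the absence of a preceding column.
Attached : ∀ {k} → Maybe (Column k) → Column k → Fin k → Set
Attached nothing  d x = ⊥
Attached (just a) d x = ∃ λ j → lookup a j ≡ x × lookup d j ≡ x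

attached? : ∀ {k} (a : Maybe (Column k)) d → Decidable (Attached a d)
attached? nothing  d x = no λ ()
attached? (just a) d x = Fin.any? λ j → (lookup a j Fin.≟ x) ×-dec (lookup d j Fin.≟ x)

-- The first height of the color `x`, which represents all its heights in the column. The last entry
-- is returned untested, since `x` is meant to occur.
leader : ∀ {k n} → Vec (Fin k) (suc n) → Fin k → Fin (suc n)
leader (a ∷ [])    x = zero
leader (a ∷ b ∷ d) x = if does (a Fin.≟ x) then zero else suc (leader (b ∷ d) x)

NewRoot : ∀ {k} → Maybe (Column k) → Column k → Pred (Fin 3) 0ℓ
NewRoot a d i = ¬ Attached a d (lookup d i) × leader d (lookup d i) ≡ i

newRoot? : ∀ {k} (a : Maybe (Column k)) d → Decidable (NewRoot a d)
newRoot? a d i = ¬? (attached? a d (lookup d i)) ×-dec (leader d (lookup d i) Fin.≟ i)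

newRoots : ∀ {k} → Maybe (Column k) → Column k → List (Fin 3)
newRoots a d = filter (newRoot? a d) (allFin 3)

-- With `nothing` no color is attached, so `newBlocks nothing d` is the number of colors of `d`:
-- this is what indexes the 3 × 3 matrix.
newBlocks : ∀ {k} → Maybe (Column k) → Column k → ℕ
newBlocks a d = length (newRoots a d)

length-filter-⇔ : ∀ {A : Set} {P Q : Pred A 0ℓ} (P? : Decidable P) (Q? : Decidable Q) →
  (∀ x → P x ⇔ Q x) → ∀ xs → length (filter P? xs) ≡ length (filter Q? xs)
length-filter-⇔ P? Q? e []       = refl
length-filter-⇔ P? Q? e (x ∷ xs) with P? x | Q? x
... | yes _ | yes _ = cong suc (length-filter-⇔ P? Q? e xs)
... | no _  | no _  = length-filter-⇔ P? Q? e xs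
... | yes p | no ¬q = contradiction (Equivalence.to (e x) p) ¬q
... | no ¬p | yes q = contradiction (Equivalence.from (e x) q) ¬p

module _ {m k} (ρ : Fin m → Fin k) (inj : Injective _≡_ _≡_ ρ) where

  attached-map : ∀ a d x → Attached (Maybe.map (Vec.map ρ) a) (Vec.map ρ d) (ρ x) ⇔ Attached a d x
  attached-map nothing  d x = mk⇔ (λ ()) (λ ())
  attached-map (just a) d x = mk⇔
    (λ (j , p , q) → j , inj (trans (sym (Vec.lookup-map j ρ a)) p) , inj (trans (sym (Vec.lookup-map j ρ d)) q))
    (λ (j , p , q) → j , trans (Vec.lookup-map j ρ a) (cong ρ p) , trans (Vec.lookup-map j ρ d) (cong ρ q))

  leader-map : ∀ {n} (d : Vec (Fin m) (suc n)) x → leader (Vec.map ρ d) (ρ x) ≡ leader d x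
  leader-map (a ∷ [])    x = refl
  leader-map (a ∷ b ∷ d) x with ρ a Fin.≟ ρ x | a Fin.≟ x
  ... | yes _ | yes _ = refl
  ... | no _  | no _  = cong suc (leader-map (b ∷ d) x)
  ... | yes p | no ¬q = contradiction (inj p) ¬q
  ... | no ¬p | yes q = contradiction (cong ρ q) ¬p

  -- Colors enter the count only through equality tests, which an injective recoloring respects. All
  -- the symmetry used later comes from here.
  newBlocks-map : ∀ a d → newBlocks (Maybe.map (Vec.map ρ) a) (Vec.map ρ d) ≡ newBlocks a d
  newBlocks-map a d = length-filter-⇔ (newRoot? _ (Vec.map ρ d)) (newRoot? a d) equiv (allFin 3)
    where
    equiv : ∀ i → NewRoot (Maybe.map (Vec.map ρ) a) (Vec.map ρ d) i ⇔ NewRoot a d i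
    equiv i rewrite Vec.lookup-map i ρ d | leader-map d (lookup d i) = mk⇔
      (λ (p , q) → p ∘ Equivalence.from (attached-map a d (lookup d i)) , q)
      (λ (p , q) → p ∘ Equivalence.to (attached-map a d (lookup d i)) , q)

extend : ∀ {m n} → (Fin m → Fin n) → Fin n → Fin (suc m) → Fin n
extend ρ x zero    = x
extend ρ x (suc i) = ρ i

extend-injective : ∀ {m n} {ρ : Fin m → Fin n} {x} → Injective _≡_ _≡_ ρ → (∀ i → ρ i ≢ x) →
                   Injective _≡_ _≡_ (extend ρ x)
extend-injective inj x∉ {zero}  {zero}  e = refl
extend-injective inj x∉ {zero}  {suc j} e = contradiction (sym e) (x∉ j)
extend-injective inj x∉ {suc i} {zero}  e = contradiction e (x∉ i)
extend-injective inj x∉ {suc i} {suc j} e = cong suc (inj e)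

-- One more letter is chosen among k colors of which m are already in use, as
-- a used one or as one of the k − m unused ones (this number is `gap m`).
chooseColor : ∀ {A : Set} → Op₂ A → Op₂ A → A → (ℕ → A) →
  ∀ {l} → (∀ {m} → Vec (Fin m) (suc l) → A) → ∀ {m} → Vec (Fin m) l → A
chooseColor _+_ _*_ 0# gap G {m} w =
  foldr _+_ 0# (map (λ i → G (i ∷ w)) (allFin m)) + (gap m * G (zero ∷ Vec.map suc w))

-- Generic in the operations: on ring elements it is the value of a sum over columns, on `Expr 5`
-- the expression given to the normaliser. Letters are pushed onto the front of the word, hence the
-- reversal in `G′`.
chooseColumn : ∀ {A : Set} → Op₂ A → Op₂ A → A → (ℕ → A) →
  ∀ {l} → (∀ {m} → Column m → Vec (Fin m) l → A) → ∀ {m} → Vec (Fin m) l → A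
chooseColumn {A} _+_ _*_ 0# gap {l} G = choose (choose (choose G′))
  where
  choose : ∀ {l} → (∀ {m} → Vec (Fin m) (suc l) → A) → ∀ {m} → Vec (Fin m) l → A
  choose = chooseColor _+_ _*_ 0# gap
  G′ : ∀ {m} → Vec (Fin m) (3 ℕ.+ l) → A
  G′ (z ∷ y ∷ x ∷ w) = G (x ∷ y ∷ z ∷ []) w

words : ∀ {A : Set} → List A → ∀ n → List (Vec A n)
words xs zero    = [] ∷ []
words xs (suc n) = cartesianProductWith _∷_ xs (words xs n)

columns : ∀ k → List (Column k)
columns k = words (allFin k) 3

head? : ∀ {A : Set} {n} → Vec A n → Maybe A
head? []      = nothing
head? (d ∷ _) = just d

blocks : ∀ {k n} → Vec (Column k) n → ℕ
blocks []      = 0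
blocks (d ∷ c) = newBlocks (head? c) d ℕ.+ blocks c

byBlocks : ∀ {A : Set} → A → A → A → ℕ → A
byBlocks α β γ 1 = α
byBlocks α β γ 2 = β
-- This stands for 3 colors; a column of height 3 never has 0 colors.
byBlocks α β γ _ = γ

-- The entry in row j and column i is the coefficient of k^i y^j.
tabulated : List (List ℤ) → Expr 2
tabulated rows = horner (var (# 1)) (map (λ row → horner (var (# 0)) (map con row)) rows)
  where
  horner : ∀ {n} → Expr n → List (Expr n) → Expr n
  horner z = foldr (λ e acc → e ⊕ z ⊗ acc) ∅

-- These are k y, 3 k (k - 1) y² and k (k - 1) (k - 2) y³: the columns with 1, 2 and 3 colors, each
-- color opening a block.
firstᵗ : Vec (List (List ℤ)) 3
firstᵗ
  = ([] ∷ (+ 0 ∷ + 1 ∷ []) ∷ [])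
  ∷ ([] ∷ [] ∷ (+ 0 ∷ ℤ.- + 3 ∷ + 3 ∷ []) ∷ [])
  ∷ ([] ∷ [] ∷ [] ∷ (+ 0 ∷ + 2 ∷ ℤ.- + 3 ∷ + 1 ∷ []) ∷ [])
  ∷ []

-- The matrix M. For a fixed column `a` with i colors, the entry (i, j), counted from 1, adds up y
-- to the power `newBlocks (just a) d` over all columns `d` with j colors. For instance the entry
-- (1, 1) is 1 + (k - 1) y: a monochromatic column repeats the color of `a` or opens a block.
transferᵗ : Vec (Vec (List (List ℤ)) 3) 3
transferᵗ
  = ( ((+ 1 ∷ []) ∷ (ℤ.- + 1 ∷ + 1 ∷ []) ∷ [])
    ∷ ([] ∷ (ℤ.- + 6 ∷ + 6 ∷ []) ∷ (+ 6 ∷ ℤ.- + 9 ∷ + 3 ∷ []) ∷ [])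
    ∷ ([] ∷ [] ∷ (+ 6 ∷ ℤ.- + 9 ∷ + 3 ∷ []) ∷ (ℤ.- + 6 ∷ + 11 ∷ ℤ.- + 6 ∷ + 1 ∷ []) ∷ [])
    ∷ [] )
  ∷ ( ((+ 2 ∷ []) ∷ (ℤ.- + 2 ∷ + 1 ∷ []) ∷ [])
    ∷ ((+ 3 ∷ []) ∷ (ℤ.- + 14 ∷ + 8 ∷ []) ∷ (+ 11 ∷ ℤ.- + 11 ∷ + 3 ∷ []) ∷ [])
    ∷ ([] ∷ (ℤ.- + 4 ∷ + 2 ∷ []) ∷ (+ 14 ∷ ℤ.- + 13 ∷ + 3 ∷ []) ∷ (ℤ.- + 10 ∷ + 13 ∷ ℤ.- + 6 ∷ + 1 ∷ []) ∷ [])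
    ∷ [] )
  ∷ ( ((+ 3 ∷ []) ∷ (ℤ.- + 3 ∷ + 1 ∷ []) ∷ [])
    ∷ ((+ 6 ∷ []) ∷ (ℤ.- + 21 ∷ + 9 ∷ []) ∷ (+ 15 ∷ ℤ.- + 12 ∷ + 3 ∷ []) ∷ [])
    ∷ ((+ 1 ∷ []) ∷ (ℤ.- + 9 ∷ + 3 ∷ []) ∷ (+ 21 ∷ ℤ.- + 15 ∷ + 3 ∷ []) ∷ (ℤ.- + 13 ∷ + 14 ∷ ℤ.- + 6 ∷ + 1 ∷ []) ∷ [])
    ∷ [] )
  ∷ []

combination : ∀ {l} → Vec (List (List ℤ)) 3 → Vec (Expr (2 ℕ.+ l)) 3 → Expr (2 ℕ.+ l)
combination {l} (a ∷ b ∷ c ∷ []) (α ∷ β ∷ γ ∷ []) = entry a ⊗ α ⊕ entry b ⊗ β ⊕ entry c ⊗ γ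
  where
  entry : List (List ℤ) → Expr (2 ℕ.+ l)
  entry t = rename (Fin._↑ˡ l) (tabulated t)

-- Cramer's rule for the 3 × 3 system

module Cramer where

  k y α β γ x : Expr 6
  k = var (# 0)
  y = var (# 1)
  α = var (# 2)
  β = var (# 3)
  γ = var (# 4)
  x = var (# 5)

  infixl 6 _⊖_
  _⊖_ : Expr 6 → Expr 6 → Expr 6
  e ⊖ f = e ⊕ ⊝ f

  c : ℕ → Expr 6
  c a = con (+ a)

  -- Follows `p` operation by operation, so that its value at the series k, y, x is `p` by
  -- computation; `denominator` is related to `q` in the same way.
  numerator : Expr 6
  numerator = k ⊗ x ⊗ y ⊗
    ( c 1 ⊖ (c 1 ⊖ k) ⊗ y ⊗ (c 3 ⊖ (c 2 ⊖ k) ⊗ y)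
    ⊖ x ⊗ (c 1 ⊖ y) ⊗
        ( c 4 ⊖ y ⊗ (c 13 ⊖ c 5 ⊗ k) ⊕ (c 3 ⊕ k) ⊗ (c 3 ⊖ c 2 ⊗ k) ⊗ y ↑ 2
        ⊖ (c 1 ⊖ k) ⊗ (c 1 ⊕ (c 3 ⊖ k) ⊗ k) ⊗ y ↑ 3 )
    ⊕ x ↑ 2 ⊗ (c 1 ⊖ y) ↑ 2 ⊗
        ( c 3 ⊖ (c 2 ⊕ c 4 ⊗ k) ⊗ y ⊕ (c 1 ⊖ k ⊕ c 3 ⊗ k ↑ 2) ⊗ y ↑ 2
        ⊕ k ↑ 2 ⊗ (c 1 ⊖ k) ⊗ y ↑ 3 ) )

  codenominator : Expr 6
  codenominator =
      c 5 ⊖ c 12 ⊗ (c 2 ⊖ k) ⊗ y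
    ⊕ x ↑ 2 ⊗ (c 1 ⊖ y) ↑ 2 ⊗
        ( c 3 ⊖ (c 2 ⊕ c 4 ⊗ k) ⊗ y ⊕ k ⊗ (c 1 ⊕ c 2 ⊗ k) ⊗ y ↑ 2
        ⊕ k ⊗ (c 1 ⊖ k) ⊗ y ↑ 3 ⊖ (k ⊖ c 1) ↑ 4 ⊗ y ↑ 4 )
    ⊖ x ⊗ (c 1 ⊖ y) ⊗
        ( c 7 ⊖ (c 25 ⊖ c 8 ⊗ k) ⊗ y ⊕ (c 20 ⊖ c 3 ⊗ k ⊖ c 4 ⊗ k ↑ 2) ⊗ y ↑ 2
        ⊕ (c 5 ⊖ c 24 ⊗ k ⊕ c 21 ⊗ k ↑ 2 ⊖ c 5 ⊗ k ↑ 3) ⊗ y ↑ 3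
        ⊖ (c 7 ⊖ c 18 ⊗ k ⊕ c 17 ⊗ k ↑ 2 ⊖ c 7 ⊗ k ↑ 3 ⊕ k ↑ 4) ⊗ y ↑ 4 )
    ⊕ y ↑ 2 ⊗
        ( c 32 ⊖ c 26 ⊗ k ⊕ c 6 ⊗ k ↑ 2
        ⊖ (c 13 ⊖ c 14 ⊗ k ⊕ c 6 ⊗ k ↑ 2 ⊖ k ↑ 3) ⊗ y )

  denominator : Expr 6
  denominator = c 1 ⊖ x ⊗ codenominator

  rowᵉ : Vec (List (List ℤ)) 3 → Expr 6
  rowᵉ ts = combination ts (α ∷ β ∷ γ ∷ [])

  residual : Fin 3 → Expr 6
  residual i = lookup (α ∷ β ∷ γ ∷ []) i ⊖ x ⊗ rowᵉ (lookup transferᵗ i)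

  I-xM : Fin 3 → Fin 3 → Expr 6
  I-xM i j = (if does (i Fin.≟ j) then c 1 else c 0)
    ⊖ x ⊗ rename (Fin._↑ˡ 4) (tabulated (lookup (lookup transferᵗ i) j))

  next : Fin 3 → Fin 3
  next zero             = # 1
  next (suc zero)       = # 2
  next (suc (suc zero)) = # 0

  -- Taking the two remaining indices in cyclic order absorbs the sign of the cofactor.
  cofactor : Fin 3 → Fin 3 → Expr 6
  cofactor i j = I-xM (next i) (next j) ⊗ I-xM (next (next i)) (next (next j))
               ⊖ I-xM (next i) (next (next j)) ⊗ I-xM (next (next i)) (next j)

  -- Component i of the row x f adj(1 - x M), with f given by `firstᵗ`. The adjugate is the
  -- transpose of the cofactor matrix, so the sum runs over the second index.
  multiplier : Fin 3 → Expr 6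
  multiplier i = x ⊗ combination firstᵗ (cofactor i (# 0) ∷ cofactor i (# 1) ∷ cofactor i (# 2) ∷ [])

  module _ (R : CommutativeRing 0ℓ 0ℓ) (φ : IntegerCoefficients R) where
    open CommutativeRing R using (_≈_; *-congˡ; +-cong; setoid)
    open Evaluation R φ
    open ≈-Reasoning setoid

    cramer : ∀ ρ → (∀ i → ⟦ residual i ⟧ ρ ≈ ⟦ c 1 ⟧ ρ) →
             ⟦ denominator ⊗ (x ⊗ rowᵉ firstᵗ) ⟧ ρ ≈ ⟦ numerator ⟧ ρ
    cramer ρ e = begin
      ⟦ denominator ⊗ (x ⊗ rowᵉ firstᵗ) ⟧ ρ
        -- This is adj(1 - x M) (1 - x M) = det(1 - x M), the determinant being `denominator`; it
        -- holds in all six variables, with α, β, γ arbitrary.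
        ≈⟨ identity (denominator ⊗ (x ⊗ rowᵉ firstᵗ)) (applied residual) _ ρ ⟩
      ⟦ applied residual ⟧ ρ
        ≈⟨ +-cong (+-cong (*-congˡ (e (# 0))) (*-congˡ (e (# 1)))) (*-congˡ (e (# 2))) ⟩
      ⟦ applied (λ _ → c 1) ⟧ ρ
        -- The row x f adj(1 - x M) applied to the vector of ones is the numerator.
        ≈⟨ identity (applied (λ _ → c 1)) numerator _ ρ ⟩
      ⟦ numerator ⟧ ρ ∎
      where
      applied : (Fin 3 → Expr 6) → Expr 6
      applied f = multiplier (# 0) ⊗ f (# 0) ⊕ multiplier (# 1) ⊗ f (# 1) ⊕ multiplier (# 2) ⊗ f (# 2)

-- Sums over columns, evaluated on color patterns

module Transfer (R : CommutativeRing 0ℓ 0ℓ) (φ : IntegerCoefficients R) (k : ℕ) (y : CommutativeRing.Carrier R) where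
  open CommutativeRing R hiding (zero; refl; sym; trans; -_)
  private module R = CommutativeRing R
  open _-Raw-AlmostCommutative⟶_ φ renaming (⟦_⟧ to fromℤ)
  open FiniteSums R φ
  open Evaluation R φ
  open ≈-Reasoning setoid

  gap : ℕ → Carrier
  gap m = fromℤ (+ k) - fromℤ (+ m)

  Invariant : ∀ {l} → (∀ {m} → Vec (Fin m) l → Carrier) → Set
  Invariant G = ∀ {m n} (ρ : Fin m → Fin n) → Injective _≡_ _≡_ ρ → ∀ w → G (Vec.map ρ w) ≈ G w

  choose : ∀ {l} → (∀ {m} → Vec (Fin m) (suc l) → Carrier) → ∀ {m} → Vec (Fin m) l → Carrier
  choose = chooseColor _+_ _*_ 0# gap

  module _ {l} {G : ∀ {m} → Vec (Fin m) (suc l) → Carrier} (inv : Invariant (λ {m} → G {m})) where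

    fresh : ∀ {m n} (ρ : Fin m → Fin n) → Injective _≡_ _≡_ ρ → ∀ x → (∀ i → ρ i ≢ x) →
            ∀ w → G (x ∷ Vec.map ρ w) ≈ G (zero ∷ Vec.map suc w)
    fresh ρ inj x x∉ w = begin
      G (x ∷ Vec.map ρ w)                                ≈⟨ R.reflexive (cong (λ v → G (x ∷ v)) (Vec.map-∘ (extend ρ x) suc w)) ⟩
      G (Vec.map (extend ρ x) (zero ∷ Vec.map suc w))    ≈⟨ inv (extend ρ x) (extend-injective inj x∉) _ ⟩
      G (zero ∷ Vec.map suc w)                           ∎

    choose-invariant : Invariant (λ {m} → choose G {m})
    choose-invariant {m} {n} ρ inj w = begin
      ∑ (allFin n) (λ x → G (x ∷ Vec.map ρ w)) + gap n * G (zero ∷ Vec.map suc (Vec.map ρ w))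
        ≈⟨ +-cong (∑-Fin-split ρ inj _ r (λ x x∉ → fresh ρ inj x x∉ w)) (*-congˡ unused) ⟩
      ∑ (allFin m) (λ i → G (ρ i ∷ Vec.map ρ w)) + (fromℤ (+ n) - fromℤ (+ m)) * r + gap n * r
        ≈⟨ +-assoc _ _ _ ⟩
      ∑ (allFin m) (λ i → G (ρ i ∷ Vec.map ρ w)) + ((fromℤ (+ n) - fromℤ (+ m)) * r + gap n * r)
        ≈⟨ +-cong (∑-cong (allFin m) (λ i → inv ρ inj (i ∷ w))) telescope ⟩
      ∑ (allFin m) (λ i → G (i ∷ w)) + gap m * r ∎
      where
      r = G (zero ∷ Vec.map suc w)

      unused : G (zero ∷ Vec.map suc (Vec.map ρ w)) ≈ r
      unused = R.trans (R.reflexive (cong (λ v → G (zero ∷ v)) (sym (Vec.map-∘ suc ρ w))))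
        (fresh (suc ∘ ρ) (inj ∘ Fin.suc-injective) zero (λ _ ()) w)

      telescope : (fromℤ (+ n) - fromℤ (+ m)) * r + gap n * r ≈ gap m * r
      telescope = identity
        ((N ⊕ ⊝ M) ⊗ S ⊕ (K ⊕ ⊝ N) ⊗ S) ((K ⊕ ⊝ M) ⊗ S) _ (fromℤ (+ k) ∷ fromℤ (+ m) ∷ fromℤ (+ n) ∷ r ∷ [])
        where
        K M N S : Expr 4
        K = var zero
        M = var (suc zero)
        N = var (suc (suc zero))
        S = var (suc (suc (suc zero)))

    -- When all k colors are named, the gap is k - k = 0 and only the genuine sum is left.
    choose-∑ : ∀ w → choose G w ≈ ∑ (allFin k) (λ x → G (x ∷ w))
    choose-∑ w = R.trans (+-congˡ (R.trans (*-congʳ (-‿inverseʳ _)) (zeroˡ _))) (+-identityʳ _)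

  module _ (V : ℕ → Carrier) where

    weight : ∀ {m} → Maybe (Column m) → Column m → Carrier
    weight a d = y ^ newBlocks a d * V (newBlocks nothing d)

    weight-map : ∀ {m n} (ρ : Fin m → Fin n) → Injective _≡_ _≡_ ρ → ∀ a d →
                 weight (Maybe.map (Vec.map ρ) a) (Vec.map ρ d) ≡ weight a d
    weight-map ρ inj a d = cong₂ (λ i j → y ^ i * V j) (newBlocks-map ρ inj a d) (newBlocks-map ρ inj nothing d)

    -- `previous` reads the neighboring column off the word of colors chosen so far: constantly
    -- `nothing` for a single column, `just` on words of length 3 for a transfer step.
    module _ {l} (previous : ∀ {m} → Vec (Fin m) l → Maybe (Column m))
             (natural : ∀ {m n} (ρ : Fin m → Fin n) w → previous (Vec.map ρ w) ≡ Maybe.map (Vec.map ρ) (previous w)) where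

      private
        G₃ : ∀ {m} → Vec (Fin m) (3 ℕ.+ l) → Carrier
        G₃ (z ∷ y ∷ x ∷ w) = weight (previous w) (x ∷ y ∷ z ∷ [])
        G₂ : ∀ {m} → Vec (Fin m) (2 ℕ.+ l) → Carrier
        G₂ = choose G₃
        G₁ : ∀ {m} → Vec (Fin m) (1 ℕ.+ l) → Carrier
        G₁ = choose G₂

        inv₃ : Invariant (λ {m} → G₃ {m})
        inv₃ ρ inj (z ∷ y ∷ x ∷ w) = R.trans
          (R.reflexive (cong (λ a → weight a _) (natural ρ w)))
          (R.reflexive (weight-map ρ inj (previous w) (x ∷ y ∷ z ∷ [])))
        inv₂ : Invariant (λ {m} → G₂ {m})
        inv₂ = choose-invariant {G = G₃} inv₃
        inv₁ : Invariant (λ {m} → G₁ {m})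
        inv₁ = choose-invariant {G = G₂} inv₂

      chosenColumns : ∀ {m} → Vec (Fin m) l → Carrier
      chosenColumns = chooseColumn _+_ _*_ 0# gap (λ d w → weight (previous w) d)

      -- The right side no longer mentions `ρ`: the sum over actual colors has been computed on the
      -- pattern `w`, and k survives only in the coefficients `gap`.
      ∑-columns : ∀ {m} (ρ : Fin m → Fin k) → Injective _≡_ _≡_ ρ → ∀ w →
                  ∑ (columns k) (weight (previous (Vec.map ρ w))) ≈ chosenColumns w
      ∑-columns ρ inj w = begin
        ∑ (columns k) f
          ≈⟨ ∑-product _∷_ (allFin k) (words (allFin k) 2) f ⟩
        ∑ (allFin k) (λ x → ∑ (words (allFin k) 2) (λ v → f (x ∷ v)))
          ≈⟨ ∑-cong (allFin k) (λ x → ∑-product _∷_ (allFin k) (words (allFin k) 1) (λ v → f (x ∷ v))) ⟩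
        ∑ (allFin k) (λ x → ∑ (allFin k) (λ y → ∑ (words (allFin k) 1) (λ v → f (x ∷ y ∷ v))))
          ≈⟨ ∑-cong (allFin k) (λ x → ∑-cong (allFin k) (λ y →
               R.trans (∑-product _∷_ (allFin k) ([] ∷ []) (λ v → f (x ∷ y ∷ v)))
                       (∑-cong (allFin k) (λ z → +-identityʳ _)))) ⟩
        ∑ (allFin k) (λ x → ∑ (allFin k) (λ y → ∑ (allFin k) (λ z → G₃ (z ∷ y ∷ x ∷ w′))))
          ≈⟨ ∑-cong (allFin k) (λ x → ∑-cong (allFin k) (λ y → choose-∑ {G = G₃} inv₃ (y ∷ x ∷ w′))) ⟨
        ∑ (allFin k) (λ x → ∑ (allFin k) (λ y → G₂ (y ∷ x ∷ w′)))
          ≈⟨ ∑-cong (allFin k) (λ x → choose-∑ {G = G₂} inv₂ (x ∷ w′)) ⟨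
        ∑ (allFin k) (λ x → G₁ (x ∷ w′))
          ≈⟨ choose-∑ {G = G₁} inv₁ w′ ⟨
        choose G₁ w′
          ≈⟨ choose-invariant {G = G₁} inv₁ ρ inj w ⟩
        choose G₁ w ∎
        where
        w′ = Vec.map ρ w
        f  = weight (previous w′)

  State : Set
  State = Vec Carrier 3

  value : State → ℕ → Carrier
  value s = byBlocks (lookup s (# 0)) (lookup s (# 1)) (lookup s (# 2))

  K Y A B C : Expr 5
  K = var zero
  Y = var (suc zero)
  A = var (suc (suc zero))
  B = var (suc (suc (suc zero)))
  C = var (suc (suc (suc (suc zero))))

  weightᵉ : ∀ {m} → Maybe (Column m) → Column m → Expr 5
  weightᵉ a d = Y ↑ newBlocks a d ⊗ byBlocks A B C (newBlocks nothing d)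

  gapᵉ : ℕ → Expr 5
  gapᵉ m = K ⊕ ⊝ con (+ m)

  successors : ∀ {m} → Column m → Expr 5
  successors = chooseColumn _⊕_ _⊗_ ∅ gapᵉ (λ d a → weightᵉ (just a) d)

  row : Vec (List (List ℤ)) 3 → Expr 5
  row ts = combination ts (A ∷ B ∷ C ∷ [])

  module _ (s : State) where

    env : Vec Carrier 5
    env = fromℤ (+ k) ∷ y ∷ s

    ∑-first : ∑ (columns k) (weight (value s) nothing) ≈ ⟦ row firstᵗ ⟧ env
    ∑-first = R.trans (∑-columns (value s) (λ _ → nothing) (λ _ _ → refl) {m = 0} (λ ()) (λ { {()} }) [])
      (identity (chooseColumn _⊕_ _⊗_ ∅ gapᵉ (λ d _ → weightᵉ nothing d) []) (row firstᵗ) _ env)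

    step : State
    step = tabulate λ i → ⟦ row (lookup transferᵗ i) ⟧ env

    -- Every column is an injective relabelling of one of the patterns 000, 001, 010, 011, 012, and
    -- for each of them the sum is a fixed polynomial identity.
    ∑-successor : ∀ a → ∑ (columns k) (weight (value s) (just a)) ≈ value step (newBlocks nothing a)
    ∑-successor (x ∷ y ∷ z ∷ []) = by-pattern (x Fin.≟ y) (y Fin.≟ z) (x Fin.≟ z)
      where
      Row : ∀ {m} → Column m → Set
      Row w = chosenColumns (value s) just (λ _ _ → refl) w ≈ value step (newBlocks nothing w)

      row₀₀₀ : Row {1} (# 0 ∷ # 0 ∷ # 0 ∷ [])
      row₀₀₀ = identity (successors {1} (# 0 ∷ # 0 ∷ # 0 ∷ [])) (row (lookup transferᵗ (# 0))) _ env
      -- The three patterns with two colors give the same row, since permuting heights is an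
      -- automorphism of K₃. This is why three states suffice.
      row₀₀₁ : Row {2} (# 0 ∷ # 0 ∷ # 1 ∷ [])
      row₀₀₁ = identity (successors {2} (# 0 ∷ # 0 ∷ # 1 ∷ [])) (row (lookup transferᵗ (# 1))) _ env
      row₀₁₀ : Row {2} (# 0 ∷ # 1 ∷ # 0 ∷ [])
      row₀₁₀ = identity (successors {2} (# 0 ∷ # 1 ∷ # 0 ∷ [])) (row (lookup transferᵗ (# 1))) _ env
      row₀₁₁ : Row {2} (# 0 ∷ # 1 ∷ # 1 ∷ [])
      row₀₁₁ = identity (successors {2} (# 0 ∷ # 1 ∷ # 1 ∷ [])) (row (lookup transferᵗ (# 1))) _ env
      row₀₁₂ : Row {3} (# 0 ∷ # 1 ∷ # 2 ∷ [])
      row₀₁₂ = identity (successors {3} (# 0 ∷ # 1 ∷ # 2 ∷ [])) (row (lookup transferᵗ (# 2))) _ env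

      relabel : ∀ {m} (ρ : Fin m → Fin k) → Injective _≡_ _≡_ ρ → ∀ w → Row w →
                ∑ (columns k) (weight (value s) (just (Vec.map ρ w))) ≈ value step (newBlocks nothing (Vec.map ρ w))
      relabel ρ inj w e = R.trans (∑-columns (value s) just (λ _ _ → refl) ρ inj w)
        (R.trans e (R.reflexive (cong (value step) (sym (newBlocks-map ρ inj nothing w)))))

      ρ₁ : Fin k → Fin 1 → Fin k
      ρ₁ u = extend (λ ()) u
      ρ₁-injective : ∀ u → Injective _≡_ _≡_ (ρ₁ u)
      ρ₁-injective u = extend-injective (λ { {()} }) (λ ())

      ρ₂ : Fin k → Fin k → Fin 2 → Fin k
      ρ₂ u v = extend (ρ₁ v) u
      ρ₂-injective : ∀ {u v} → u ≢ v → Injective _≡_ _≡_ (ρ₂ u v)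
      ρ₂-injective {u} {v} u≢v = extend-injective (ρ₁-injective v) (λ { zero e → u≢v (sym e) })

      by-pattern : Dec (x ≡ y) → Dec (y ≡ z) → Dec (x ≡ z) →
        ∑ (columns k) (weight (value s) (just (x ∷ y ∷ z ∷ []))) ≈ value step (newBlocks nothing (x ∷ y ∷ z ∷ []))
      by-pattern (yes refl) (yes refl) _          = relabel (ρ₁ x) (ρ₁-injective x) (# 0 ∷ # 0 ∷ # 0 ∷ []) row₀₀₀
      by-pattern (yes refl) (no y≢z)   _          = relabel (ρ₂ y z) (ρ₂-injective y≢z) (# 0 ∷ # 0 ∷ # 1 ∷ []) row₀₀₁
      by-pattern (no x≢y)   (yes refl) _          = relabel (ρ₂ x y) (ρ₂-injective x≢y) (# 0 ∷ # 1 ∷ # 1 ∷ []) row₀₁₁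
      by-pattern (no x≢y)   (no y≢z)   (yes refl) = relabel (ρ₂ x y) (ρ₂-injective x≢y) (# 0 ∷ # 1 ∷ # 0 ∷ []) row₀₁₀
      by-pattern (no x≢y)   (no y≢z)   (no x≢z)   = relabel (extend (ρ₂ y z) x)
        (extend-injective (ρ₂-injective y≢z) (λ { zero e → x≢y (sym e) ; (suc zero) e → x≢z (sym e) })) (# 0 ∷ # 1 ∷ # 2 ∷ []) row₀₁₂

  weighted : ∀ n → (Maybe (Column k) → Carrier) → Carrier
  weighted n F = ∑ (words (columns k) n) (λ c → y ^ blocks c * F (head? c))

  shift : (Maybe (Column k) → Carrier) → Maybe (Column k) → Carrier
  shift F a = ∑ (columns k) (λ d → y ^ newBlocks a d * F (just d))

  -- The front column is summed out with the rest of the coloring fixed. Of that rest it only sees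
  -- the adjacent column, so the result is again a function of a front column.
  weighted-suc : ∀ n F → weighted (suc n) F ≈ weighted n (shift F)
  weighted-suc n F = begin
    weighted (suc n) F
      ≈⟨ ∑-product _∷_ (columns k) cs _ ⟩
    ∑ (columns k) (λ d → ∑ cs (λ c → y ^ (newBlocks (head? c) d ℕ.+ blocks c) * F (just d)))
      ≈⟨ ∑-comm (columns k) cs (λ d c → y ^ (newBlocks (head? c) d ℕ.+ blocks c) * F (just d)) ⟩
    ∑ cs (λ c → ∑ (columns k) (λ d → y ^ (newBlocks (head? c) d ℕ.+ blocks c) * F (just d)))
      ≈⟨ ∑-cong cs (λ c → ∑-cong (columns k) (λ d → R.trans
           (*-congʳ (R.trans (^-+ y (newBlocks (head? c) d) (blocks c)) (*-comm _ _))) (*-assoc _ _ _))) ⟩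
    ∑ cs (λ c → ∑ (columns k) (λ d → y ^ blocks c * (y ^ newBlocks (head? c) d * F (just d))))
      ≈⟨ ∑-cong cs (λ c → ∑-*ˡ (columns k) _ _) ⟩
    weighted n (shift F) ∎
    where cs = words (columns k) n

  state : ℕ → State
  state zero    = replicate 3 (fromℤ (+ 1))
  state (suc n) = step (state n)

  total : State → Carrier
  total s = ⟦ row firstᵗ ⟧ (env s)

  iterate : ℕ → State → State
  iterate zero    s = s
  iterate (suc n) s = iterate n (step s)

  -- `F` is general because each column summed out replaces `F` by `shift F`, while `s` becomes M s.
  -- The last remaining column has no neighbor and is summed by `∑-first`.
  weighted-iterate : ∀ n s F → (∀ d → F (just d) ≈ value s (newBlocks nothing d)) →
                     weighted (suc n) F ≈ total (iterate n s)
  weighted-iterate zero s F e = begin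
    weighted 1 F                            ≈⟨ weighted-suc 0 F ⟩
    fromℤ (+ 1) * shift F nothing + 0#      ≈⟨ +-identityʳ _ ⟩
    fromℤ (+ 1) * shift F nothing           ≈⟨ R.trans (*-congʳ 1-homo) (*-identityˡ _) ⟩
    shift F nothing                         ≈⟨ ∑-cong (columns k) (λ d → *-congˡ (e d)) ⟩
    ∑ (columns k) (weight (value s) nothing) ≈⟨ ∑-first s ⟩
    total s                                 ∎
  weighted-iterate (suc n) s F e = R.trans (weighted-suc (suc n) F)
    (weighted-iterate n (step s) (shift F) λ a →
      R.trans (∑-cong (columns k) (λ d → *-congˡ (e d))) (∑-successor s a))

  iterate-step : ∀ n s → iterate n (step s) ≡ step (iterate n s)
  iterate-step zero    s = refl
  iterate-step (suc n) s = iterate-step n (step s)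

  iterate-state : ∀ n → iterate n (state 0) ≡ state n
  iterate-state zero    = refl
  iterate-state (suc n) = trans (iterate-step n (state 0)) (cong step (iterate-state n))

  ∑-colorings : ∀ n → ∑ (words (columns k) (suc n)) (λ c → y ^ blocks c) ≈ total (state n)
  ∑-colorings n = begin
    ∑ (words (columns k) (suc n)) (λ c → y ^ blocks c)
      ≈⟨ ∑-cong (words (columns k) (suc n)) (λ c → R.trans (*-congˡ 1-homo) (*-identityʳ _)) ⟨
    weighted (suc n) (λ _ → fromℤ (+ 1))
      ≈⟨ weighted-iterate n (state 0) _ (λ d → constantly (newBlocks nothing d)) ⟩
    total (iterate n (state 0))
      ≡⟨ cong total (iterate-state n) ⟩
    total (state n) ∎
    where
    constantly : ∀ j → fromℤ (+ 1) ≈ value (state 0) j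
    constantly 0                   = R.refl
    constantly 1                   = R.refl
    constantly 2                   = R.refl
    constantly (suc (suc (suc _))) = R.refl

-- Colored partitions and colorings

open Graph
open ColoredPartition
open Finiteness using (uip)

vertexColor : ∀ {k G} (T : ColoredPartition k G) → Vertex G → Fin k
vertexColor T v = color T (block T v)

module _ {k : ℕ} {G : Graph} where

  edge⇒sameBlock : (T : ColoredPartition k G) → ∀ {u v} → Adj G u v →
                   vertexColor T u ≡ vertexColor T v → block T u ≡ block T v
  edge⇒sameBlock T {u} {v} a e with block T u Fin.≟ block T v
  ... | yes b = b
  ... | no ¬b = contradiction e
    (IsColoredPartition.proper (isColoredPartition T) _ _ ¬b (u , v , refl , refl , a))

  -- A walk inside a block of `S` has constant color, and properness of `T` keeps the ends of a
  -- monochromatic edge in one block of `T`.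
  sameColoring⇒block : (S T : ColoredPartition k G) → (∀ v → vertexColor S v ≡ vertexColor T v) →
                       ∀ {u v} → block S u ≡ block S v → block T u ≡ block T v
  sameColoring⇒block S T e {u} {v} b =
    along (IsColoredPartition.connected (isColoredPartition S) (block S v) (u , b) (v , refl))
    where
    along : ∀ {i} {u v : ∃ (Fiber (block S) i)} → Star (Adj (induced G (Fiber (block S) i))) u v →
            block T (proj₁ u) ≡ block T (proj₁ v)
    along ε = refl
    along {u = u , p} (_◅_ {j = v , q} a s) = trans
      (edge⇒sameBlock T a (trans (sym (e u)) (trans (cong (color S) (trans p (sym q))) (e v)))) (along s)

  sameColoring⇒≈ₜ : (S T : ColoredPartition k G) → (∀ v → vertexColor S v ≡ vertexColor T v) → S ≈ₜ T
  sameColoring⇒≈ₜ S T e =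
    (λ u v → mk⇔ (sameColoring⇒block S T e) (sameColoring⇒block T S (λ v → sym (e v)))) , e

  ≈ₜ⇒ρ≤ : (S T : ColoredPartition k G) → S ≈ₜ T → ρ S ℕ.≤ ρ T
  ≈ₜ⇒ρ≤ S T S≈T = Fin.injective⇒≤ {f = block T ∘ representative} λ {i} {j} e →
    trans (sym (proj₂ (nonempty i)))
      (trans (Equivalence.from (_≈ₜ_.sameBlocks S≈T _ _) e) (proj₂ (nonempty j)))
    where
    open IsColoredPartition (isColoredPartition S)
    representative : Fin (ρ S) → Vertex G
    representative i = proj₁ (nonempty i)

  sameColoring⇒ρ≡ : (S T : ColoredPartition k G) → (∀ v → vertexColor S v ≡ vertexColor T v) → ρ S ≡ ρ T
  sameColoring⇒ρ≡ S T e = ℕ.≤-antisym (≈ₜ⇒ρ≤ S T (sameColoring⇒≈ₜ S T e))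
                                      (≈ₜ⇒ρ≤ T S (sameColoring⇒≈ₜ T S (λ v → sym (e v))))

lookup-injective : ∀ {A : Set} {xs : List A} → Unique xs → ∀ {i j} → List.lookup xs i ≡ List.lookup xs j → i ≡ j
lookup-injective (x∉ ∷ _)  {zero}  {zero}  e = refl
lookup-injective (x∉ ∷ _)  {zero}  {suc j} e = contradiction e (All.lookup x∉ (∈-lookup j))
lookup-injective (x∉ ∷ _)  {suc i} {zero}  e = contradiction (sym e) (All.lookup x∉ (∈-lookup i))
lookup-injective (_ ∷ xs!) {suc i} {suc j} e = cong suc (lookup-injective xs! e)

-- Partitions from a root in each monochromatic component

Monochromatic : (G : Graph) {C : Set} → (Vertex G → C) → Vertex G → Vertex G → Set
Monochromatic G χ u v = Adj G u v × χ u ≡ χ v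

-- One vertex chosen in each monochromatic component, without computing components: `walk` places a
-- vertex in the component of its root, and `root-edge` makes the root constant on components.
record Rooting {G : Graph} {k : ℕ} (χ : Vertex G → Fin k) : Set where
  field
    root        : Vertex G → Vertex G
    roots       : List (Vertex G)
    unique      : Unique roots
    root∈roots  : ∀ v → root v ∈ roots
    root-roots  : ∀ {r} → r ∈ roots → root r ≡ r
    walk        : ∀ v → Star (Monochromatic G χ) v (root v)
    root-edge   : ∀ {u v} → Monochromatic G χ u v → root u ≡ root v

  walk-color : ∀ {u v} → Star (Monochromatic G χ) u v → χ u ≡ χ v
  walk-color ε             = refl
  walk-color ((_ , e) ◅ s) = trans e (walk-color s)

  rootIndex : Vertex G → Fin (length roots)
  rootIndex v = index (root∈roots v)

  lookup-rootIndex : ∀ v → List.lookup roots (rootIndex v) ≡ root v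
  lookup-rootIndex v = sym (lookup-index (root∈roots v))

  rootIndex-cong : ∀ {u v} → root u ≡ root v → rootIndex u ≡ rootIndex v
  rootIndex-cong {u} {v} e = lookup-injective unique
    (trans (lookup-rootIndex u) (trans e (sym (lookup-rootIndex v))))

  rootIndex-injective : ∀ {u v} → rootIndex u ≡ rootIndex v → root u ≡ root v
  rootIndex-injective {u} {v} e = trans (sym (lookup-rootIndex u))
    (trans (cong (List.lookup roots) e) (lookup-rootIndex v))

  color-rootIndex : ∀ v → χ (List.lookup roots (rootIndex v)) ≡ χ v
  color-rootIndex v = trans (cong χ (lookup-rootIndex v)) (sym (walk-color (walk v)))

  partition : ColoredPartition k G
  partition = coloredPartition (length roots) rootIndex (χ ∘ List.lookup roots) record
    { nonempty = λ i → List.lookup roots i , lookup-injective unique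
        (trans (lookup-rootIndex _) (root-roots (∈-lookup i)))
    ; connected = λ { i (u , p) (v , q) → lift p q (walk u ◅◅
        subst (λ r → Star (Monochromatic G χ) r v) (rootIndex-injective (trans q (sym p)))
          (reverse (λ (a , e) → symm G a , sym e) (walk v))) }
    ; proper = λ { i j i≢j (u , v , refl , refl , a) e → i≢j (rootIndex-cong
        (root-edge (a , trans (sym (color-rootIndex u)) (trans e (color-rootIndex v))))) }
    }
    where
    lift : ∀ {i u v} (p : rootIndex u ≡ i) (q : rootIndex v ≡ i) → Star (Monochromatic G χ) u v →
           Star (Adj (induced G (Fiber rootIndex i))) (u , p) (v , q)
    lift p q ε = subst (λ q → Star _ (_ , p) (_ , q)) (uip p q) ε
    lift p q (_◅_ {j = w} (a , e) s) =
      _◅_ {j = w , trans (sym (rootIndex-cong (root-edge (a , e)))) p} a (lift _ q s)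

lookup-leader : ∀ {k n} (d : Vec (Fin k) (suc n)) i → lookup d (leader d (lookup d i)) ≡ lookup d i
lookup-leader (a ∷ [])    zero = refl
lookup-leader (a ∷ b ∷ d) i with a Fin.≟ lookup (a ∷ b ∷ d) i
... | yes e = e
lookup-leader (a ∷ b ∷ d) zero    | no ¬e = contradiction refl ¬e
lookup-leader (a ∷ b ∷ d) (suc i) | no _  = lookup-leader (b ∷ d) i

colorAt : ∀ {k n} → Vec (Column k) n → Vertex (U n) → Fin k
colorAt c (i , j) = lookup (lookup c j) i

words-complete : ∀ {A : Set} {xs : List A} → (∀ x → x ∈ xs) → ∀ {n} (w : Vec A n) → w ∈ words xs n
words-complete all []      = here refl
words-complete all (x ∷ w) = ∈-cartesianProductWith⁺ _∷_ (all x) (words-complete all w)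

words-unique : ∀ {A : Set} {xs : List A} → Unique xs → ∀ n → Unique (words xs n)
words-unique xs! zero    = [] ∷ []
words-unique xs! (suc n) = Unique.cartesianProductWith⁺ _∷_ Vec.∷-injective xs! (words-unique xs! n)

-- Roots for the colorings of K₃ × Pₙ

module _ {k : ℕ} where

  Walk : ∀ {n} → Vec (Column k) n → Vertex (U n) → Vertex (U n) → Set
  Walk {n} c = Star (Monochromatic (U n) (colorAt c))

  raise : ∀ {n} → Vertex (U n) → Vertex (U (suc n))
  raise (i , j) = i , suc j

  -- An attached color inherits the root of the next column, any other color is rooted at its
  -- leader. `frontRoot` receives the color and not the height, so equal colors in the front column
  -- get equal roots at once.
  root : ∀ {n} → Vec (Column k) n → Vertex (U n) → Vertex (U n)
  attachedRoot : ∀ {n} (c : Vec (Column k) n) d x → Attached (head? c) d x → Vertex (U n)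
  frontRoot : ∀ {n} (c : Vec (Column k) n) d x → Dec (Attached (head? c) d x) → Vertex (U (suc n))

  root (d ∷ c) (i , zero)  = frontRoot c d (lookup d i) (attached? (head? c) d (lookup d i))
  root (d ∷ c) (i , suc j) = raise (root c (i , j))

  attachedRoot (a ∷ c) d x (j , _) = root (a ∷ c) (j , zero)

  frontRoot c d x (yes p) = raise (attachedRoot c d x p)
  frontRoot c d x (no _)  = leader d x , zero

  roots : ∀ {n} → Vec (Column k) n → List (Vertex (U n))
  roots []      = []
  roots (d ∷ c) = map (_, zero) (newRoots (head? c) d) ++ map raise (roots c)

  length-roots : ∀ {n} (c : Vec (Column k) n) → length (roots c) ≡ blocks c
  length-roots []      = refl
  length-roots (d ∷ c) = trans (length-++ (map (_, zero) (newRoots (head? c) d)))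
    (cong₂ ℕ._+_ (length-map (_, zero) (newRoots (head? c) d)) (trans (length-map raise (roots c)) (length-roots c)))

  roots-unique : ∀ {n} (c : Vec (Column k) n) → Unique (roots c)
  roots-unique []      = []
  roots-unique (d ∷ c) = Unique.++⁺
    (Unique.map⁺ (cong proj₁) (Unique.filter⁺ (newRoot? (head? c) d) (Unique.allFin⁺ 3)))
    (Unique.map⁺ (λ { refl → refl }) (roots-unique c))
    λ (p , q) → disjoint (∈-map⁻ (_, zero) p) (∈-map⁻ raise q)
    where
    disjoint : ∀ {v} → (∃ λ i → i ∈ newRoots (head? c) d × v ≡ (i , zero)) →
               (∃ λ u → u ∈ roots c × v ≡ raise u) → ⊥
    disjoint (_ , _ , refl) (_ , _ , ())

  root∈roots : ∀ {n} (c : Vec (Column k) n) v → root c v ∈ roots c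
  root∈roots (d ∷ c) (i , suc j) = ∈-++⁺ʳ (map (_, zero) (newRoots (head? c) d)) (∈-map⁺ raise (root∈roots c (i , j)))
  root∈roots (d ∷ c) (i , zero) with attached? (head? c) d (lookup d i)
  ... | no ¬p = ∈-++⁺ˡ (∈-map⁺ (_, zero) (∈-filter⁺ (newRoot? (head? c) d) (∈-allFin _)
          (subst (¬_ ∘ Attached (head? c) d) (sym (lookup-leader d i)) ¬p , cong (leader d) (lookup-leader d i))))
  ... | yes p = ∈-++⁺ʳ (map (_, zero) (newRoots (head? c) d)) (∈-map⁺ raise (attachedRoot∈ c p))
    where
    attachedRoot∈ : ∀ {n} (c : Vec (Column k) n) {d x} p → attachedRoot c d x p ∈ roots c
    attachedRoot∈ (a ∷ c) (j , _) = root∈roots (a ∷ c) (j , zero)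

  root-roots : ∀ {n} (c : Vec (Column k) n) {r} → r ∈ roots c → root c r ≡ r
  root-roots (d ∷ c) r∈ with ∈-++⁻ (map (_, zero) (newRoots (head? c) d)) r∈
  ... | inj₂ q with u , u∈ , refl ← ∈-map⁻ raise q = cong raise (root-roots c u∈)
  ... | inj₁ q with i , i∈ , refl ← ∈-map⁻ (_, zero) q
               with ¬p , e ← proj₂ (∈-filter⁻ (newRoot? (head? c) d) {xs = allFin 3} i∈)
               with attached? (head? c) d (lookup d i)
  ...   | yes p = contradiction p ¬p
  ...   | no _  = cong (_, zero) e

  raise-walk : ∀ {n} {c : Vec (Column k) n} {d u v} → Walk c u v → Walk (d ∷ c) (raise u) (raise v)
  raise-walk = gmap raise λ
    { (inj₁ (refl , inj₁ e) , f) → inj₁ (refl , inj₁ (cong suc e)) , f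
    ; (inj₁ (refl , inj₂ e) , f) → inj₁ (refl , inj₂ (cong suc e)) , f
    ; (inj₂ (refl , e) , f) → inj₂ (refl , e) , f }

  column-walk : ∀ {n} (c : Vec (Column k) n) {i i′ j} → colorAt c (i , j) ≡ colorAt c (i′ , j) →
                Walk c (i , j) (i′ , j)
  column-walk c {i} {i′} e with i Fin.≟ i′
  ... | yes refl = ε
  ... | no i≢i′  = (inj₂ (refl , i≢i′) , e) ◅ ε

  root-walk : ∀ {n} (c : Vec (Column k) n) v → Walk c v (root c v)
  root-walk (d ∷ c) (i , suc j) = raise-walk (root-walk c (i , j))
  root-walk (d ∷ c) (i , zero) with attached? (head? c) d (lookup d i)
  ... | no _  = column-walk (d ∷ c) (sym (lookup-leader d i))
  ... | yes p = attached-walk c p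
    where
    attached-walk : ∀ {n} (c : Vec (Column k) n) p →
                    Walk (d ∷ c) (i , zero) (raise (attachedRoot c d (lookup d i) p))
    attached-walk (a ∷ c) (j , a≡ , d≡) = column-walk (d ∷ a ∷ c) (sym d≡) ◅◅
      (inj₁ (refl , inj₁ refl) , trans d≡ (sym a≡)) ◅ raise-walk (root-walk (a ∷ c) (j , zero))

  frontRoot-cong : ∀ {n} (c : Vec (Column k) n) d {x y} → x ≡ y →
                   frontRoot c d x (attached? (head? c) d x) ≡ frontRoot c d y (attached? (head? c) d y)
  frontRoot-cong c d refl = refl

  -- Attachment may have been witnessed at another height j, but `a` has the same color at i and j,
  -- hence the same root there. So a front column never merges two blocks; this is where the
  -- completeness of K₃ matters.
  root-across : ∀ {n} (a d : Column k) (c : Vec (Column k) n) i → lookup d i ≡ lookup a i →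
                root (d ∷ a ∷ c) (i , zero) ≡ root (d ∷ a ∷ c) (i , suc zero)
  root-across a d c i e with attached? (just a) d (lookup d i)
  ... | no ¬p            = contradiction (i , sym e , refl) ¬p
  ... | yes (j , a≡ , _) = cong raise (frontRoot-cong c a (trans a≡ e))

  root-edge : ∀ {n} (c : Vec (Column k) n) {u v} → Monochromatic (U n) (colorAt c) u v → root c u ≡ root c v
  root-edge (d ∷ c) {i , zero}  {i′ , zero}  (inj₂ (refl , _) , e) = frontRoot-cong c d e
  root-edge (d ∷ c) {i , zero}  {i′ , zero}  (inj₁ (_ , inj₁ ()) , _)
  root-edge (d ∷ c) {i , zero}  {i′ , zero}  (inj₁ (_ , inj₂ ()) , _)
  root-edge (d ∷ c) {i , suc j} {i′ , suc j} (inj₂ (refl , a) , e) = cong raise (root-edge c (inj₂ (refl , a) , e))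
  root-edge (d ∷ c) {i , suc j} {i , suc j′} (inj₁ (refl , inj₁ a) , e) =
    cong raise (root-edge c (inj₁ (refl , inj₁ (ℕ.suc-injective a)) , e))
  root-edge (d ∷ c) {i , suc j} {i , suc j′} (inj₁ (refl , inj₂ a) , e) =
    cong raise (root-edge c (inj₁ (refl , inj₂ (ℕ.suc-injective a)) , e))
  root-edge (d ∷ a ∷ c) {i , zero}     {i , suc zero} (inj₁ (refl , inj₁ refl) , e) = root-across a d c i e
  root-edge (d ∷ a ∷ c) {i , suc zero} {i , zero}     (inj₁ (refl , inj₂ refl) , e) = sym (root-across a d c i (sym e))

  rooting : ∀ {n} (c : Vec (Column k) n) → Rooting {U n} (colorAt c)
  rooting c = record
    { root       = root c
    ; roots      = roots c
    ; unique     = roots-unique c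
    ; root∈roots = root∈roots c
    ; root-roots = root-roots c
    ; walk       = root-walk c
    ; root-edge  = root-edge c
    }

  -- The bijection between colored partitions and colorings

  coloring : ∀ {n} → ColoredPartition k (U n) → Vec (Column k) n
  coloring T = tabulate (λ j → tabulate (λ i → vertexColor T (i , j)))

  colorAt-coloring : ∀ {n} (T : ColoredPartition k (U n)) v → colorAt (coloring T) v ≡ vertexColor T v
  colorAt-coloring T (i , j) = trans (cong (λ d → lookup d i) (Vec.lookup∘tabulate _ j))
    (Vec.lookup∘tabulate (λ i → vertexColor T (i , j)) i)

  colorAt-injective : ∀ {n} {c c′ : Vec (Column k) n} → (∀ v → colorAt c v ≡ colorAt c′ v) → c ≡ c′
  colorAt-injective e = lookup-ext λ j → lookup-ext λ i → e (i , j)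
    where
    lookup-ext : ∀ {A : Set} {n} {xs ys : Vec A n} → (∀ i → lookup xs i ≡ lookup ys i) → xs ≡ ys
    lookup-ext {xs = xs} {ys} e = trans (sym (Vec.tabulate∘lookup xs))
      (trans (Vec.tabulate-cong e) (Vec.tabulate∘lookup ys))

  -- The rooted partition built from the coloring of `T` may number its blocks differently, but
  -- having the same coloring it has as many blocks.
  ρ≡blocks : ∀ {n} (T : ColoredPartition k (U n)) → ρ T ≡ blocks (coloring T)
  ρ≡blocks T = trans (sameColoring⇒ρ≡ T (Rooting.partition (rooting (coloring T)))
      (λ v → sym (trans (Rooting.color-rootIndex (rooting (coloring T)) v) (colorAt-coloring T v))))
    (length-roots (coloring T))

  -- Distinct entries of `𝒯` differ as colorings because the coloring determines the partition up to
  -- `≈ₜ`; every coloring is reached by its rooted partition.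
  colorings↭ : ∀ n → map coloring (𝒯 k (U-finite n)) ↭ words (columns k) n
  colorings↭ n = unique∧set⇒↭
    (SetoidUnique.map⁺ (≈ₜ-setoid k (U n)) (≡.setoid _) coloring-injective (𝒯-unique k (U-finite n)))
    (words-unique (words-unique (Unique.allFin⁺ k) 3) n)
    (λ _ → words-complete (words-complete ∈-allFin) _)
    (λ {c} _ → realised c)
    where
    coloring-injective : ∀ {S T} → coloring S ≡ coloring T → S ≈ₜ T
    coloring-injective {S} {T} e = sameColoring⇒≈ₜ S T λ v →
      trans (sym (colorAt-coloring S v)) (trans (cong (λ c → colorAt c v) e) (colorAt-coloring T v))

    realised : ∀ c → c ∈ map coloring (𝒯 k (U-finite n))
    realised c with T , T∈ , e ← find (𝒯-complete k (U-finite n) (Rooting.partition (rooting c))) =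
      subst (_∈ map coloring (𝒯 k (U-finite n)))
        (colorAt-injective λ v → trans (colorAt-coloring T v)
          (trans (sym (_≈ₜ_.sameColors e v)) (Rooting.color-rootIndex (rooting c) v)))
        (∈-map⁺ coloring T∈)

-- The generating function

open PowerSeries using (X; Y) renaming (_+_ to _+ₛ_; _*_ to _*ₛ_; _-_ to _-ₛ_; #_ to #ₛ_)
open ℤ[y]⟦x⟧ using (constant)

ℤ→Poly : IntegerCoefficients Poly-commutativeRing
ℤ→Poly = record
  { ⟦_⟧    = _∷ []
  ; +-homo = λ _ _ → P.refl
  ; *-homo = λ _ _ → coeffwise λ { zero → sym (ℤ.+-identityʳ _) ; (suc i) → refl }
  ; -‿homo = λ _ → P.refl
  ; 0-homo = coeffwise λ { zero → refl ; (suc i) → refl }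
  ; 1-homo = P.refl
  }

constant-cong : ∀ {f g} → f ≃ₚ g → constant f ≃ₛ constant g
constant-cong e = termwise λ { zero → e ; (suc n) → P.refl }

constant-*ₛ : ∀ f F n → (constant f *ₛ F) n ≃ₚ f *ₚ F n
constant-*ₛ f F n = P.trans (*≈⊛ (constant f) F n) (ℤ[y]⟦x⟧.constant-⊛ f F n)

constant-+ : ∀ f g → constant (f +ₚ g) ≃ₛ constant f +ₛ constant g
constant-+ f g = termwise λ { zero → P.refl ; (suc n) → P.refl }

constant-* : ∀ f g → constant (f *ₚ g) ≃ₛ constant f *ₛ constant g
constant-* f g = termwise λ
  { zero    → P.sym (constant-*ₛ f (constant g) 0)
  ; (suc n) → P.sym (P.trans (constant-*ₛ f (constant g) (suc n)) (P.zeroʳ f)) }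

constant-neg : ∀ f → constant (-ₚ f) ≃ₛ S.- constant f
constant-neg f = termwise λ { zero → P.refl ; (suc n) → P.refl }

-- By cases, so that the value at + a is # a by computation.
fromℤ : ℤ → Series
fromℤ (+ a)    = #ₛ a
fromℤ -[1+ a ] = S.- (#ₛ suc a)

fromℤ≈constant : ∀ a → fromℤ a ≃ₛ constant (a ∷ [])
fromℤ≈constant (+ a)    = termwise (#≈constant a)
fromℤ≈constant -[1+ a ] = S.trans (S.-‿cong (termwise (#≈constant (suc a)))) (S.sym (constant-neg (+ suc a ∷ [])))

ℤ→Series : IntegerCoefficients Series-commutativeRing
ℤ→Series = record
  { ⟦_⟧    = fromℤ
  ; +-homo = λ a b → via (a ℤ.+ b) (S.trans (constant-+ (a ∷ []) (b ∷ []))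
               (S.sym (S.+-cong (fromℤ≈constant a) (fromℤ≈constant b))))
  ; *-homo = λ a b → via (a ℤ.* b) (S.trans
               (S.trans (constant-cong (*-homo a b)) (constant-* (a ∷ []) (b ∷ [])))
               (S.sym (S.*-cong (fromℤ≈constant a) (fromℤ≈constant b))))
  ; -‿homo = λ a → via (ℤ.- a) (S.trans (constant-neg (a ∷ [])) (S.sym (S.-‿cong (fromℤ≈constant a))))
  ; 0-homo = via (+ 0) (termwise λ { zero → 0-homo ; (suc n) → P.refl })
  ; 1-homo = S.refl
  }
  where
  open _-Raw-AlmostCommutative⟶_ ℤ→Poly
  via : ∀ a {F} → constant (a ∷ []) ≃ₛ F → fromℤ a ≃ₛ F
  via a = S.trans (fromℤ≈constant a)

module EP = Evaluation Poly-commutativeRing ℤ→Poly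
module ES = Evaluation Series-commutativeRing ℤ→Series

-- Bridge between the two evaluations: the matrix entries involve only k and y, hence are constant
-- as series in x.
constant-⟦⟧ : ∀ {n} (e : Expr n) ρ σ → (∀ i → lookup σ i ≃ₛ constant (lookup ρ i)) →
              ES.⟦ e ⟧ σ ≃ₛ constant (EP.⟦ e ⟧ ρ)
constant-⟦⟧ ∅       ρ σ r = termwise λ { zero → P.refl ; (suc n) → P.refl }
constant-⟦⟧ (con a) ρ σ r = fromℤ≈constant a
constant-⟦⟧ (var i) ρ σ r = r i
constant-⟦⟧ (e ⊕ f) ρ σ r = S.trans (S.+-cong (constant-⟦⟧ e ρ σ r) (constant-⟦⟧ f ρ σ r)) (S.sym (constant-+ _ _))
constant-⟦⟧ (e ⊗ f) ρ σ r = S.trans (S.*-cong (constant-⟦⟧ e ρ σ r) (constant-⟦⟧ f ρ σ r)) (S.sym (constant-* _ _))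
constant-⟦⟧ (⊝ e)   ρ σ r = S.trans (S.-‿cong (constant-⟦⟧ e ρ σ r)) (S.sym (constant-neg _))

-- Multiplication by x and division of series

X∘suc≈1 : ∀ n → X (suc n) ≃ₚ constant (+ 1 ∷ []) n
X∘suc≈1 zero    = P.refl
X∘suc≈1 (suc n) = P.refl

X*-zero : ∀ F → (X *ₛ F) 0 ≃ₚ []
X*-zero F = *≈⊛ X F 0

X*-suc : ∀ F n → (X *ₛ F) (suc n) ≃ₚ F n
X*-suc F n = P.trans (*≈⊛ X F (suc n)) (P.trans
  (ℤ[y]⟦x⟧.⊛-cong X∘suc≈1 (λ _ → P.refl) n)
  (ℤ[y]⟦x⟧.⊛-identityˡ F n))

X*-unique : ∀ {F G} → F 0 ≃ₚ + 1 ∷ [] → (∀ n → F (suc n) ≃ₚ G n) → F ≃ₛ #ₛ 1 +ₛ X *ₛ G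
X*-unique {F} {G} z s = termwise λ
  { zero    → P.trans z (P.sym (P.trans (P.+-congˡ {+ 1 ∷ []} (X*-zero G)) (P.+-identityʳ (+ 1 ∷ []))))
  ; (suc n) → P.trans (s n) (P.sym (X*-suc G n)) }

remainder : ∀ {F G} → F ≃ₛ #ₛ 1 +ₛ G → F -ₛ G ≃ₛ #ₛ 1
remainder {F} {G} e = begin
  F S.+ S.- G              ≈⟨ S.+-congʳ e ⟩
  #ₛ 1 S.+ G S.+ S.- G     ≈⟨ S.+-assoc (#ₛ 1) G (S.- G) ⟩
  #ₛ 1 S.+ (G S.+ S.- G)   ≈⟨ S.+-congˡ (S.-‿inverseʳ G) ⟩
  #ₛ 1 S.+ S.0#            ≈⟨ S.+-identityʳ (#ₛ 1) ⟩
  #ₛ 1                     ∎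
  where open ≈-Reasoning S.setoid

1-X*-inverse : ∀ H → (#ₛ 1 -ₛ X *ₛ H) *ₛ ℤ[y]⟦x⟧.geometric H ≃ₛ #ₛ 1
1-X*-inverse H = begin
  (#ₛ 1 -ₛ X *ₛ H) *ₛ G          ≈⟨ S.distribʳ G (#ₛ 1) (S.- (X *ₛ H)) ⟩
  #ₛ 1 *ₛ G +ₛ (S.- (X *ₛ H)) *ₛ G ≈⟨ S.+-cong (S.*-identityˡ G) (S.sym (-‿distribˡ-* (X *ₛ H) G)) ⟩
  G -ₛ X *ₛ H *ₛ G               ≈⟨ S.+-congˡ (S.-‿cong (S.*-assoc X H G)) ⟩
  G -ₛ X *ₛ (H *ₛ G)             ≈⟨ remainder (X*-unique {G} {H *ₛ G} P.refl
                                      (λ n → P.trans (ℤ[y]⟦x⟧.geometric-suc H n) (P.sym (*≈⊛ H G n)))) ⟩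
  #ₛ 1                           ∎
  where
  open ≈-Reasoning S.setoid
  open import Algebra.Properties.Ring S.ring using (-‿distribˡ-*)
  G = ℤ[y]⟦x⟧.geometric H

quotient : ∀ {F P Q Q⁻¹} → Q *ₛ Q⁻¹ ≃ₛ #ₛ 1 → Q *ₛ F ≃ₛ P → F ≃ₛ P *ₛ Q⁻¹
quotient {F} {P} {Q} {Q⁻¹} inv e = begin
  F                  ≈⟨ S.*-identityʳ F ⟨
  F *ₛ #ₛ 1          ≈⟨ S.*-congˡ {F} inv ⟨
  F *ₛ (Q *ₛ Q⁻¹)    ≈⟨ S.*-assoc F Q Q⁻¹ ⟨
  F *ₛ Q *ₛ Q⁻¹      ≈⟨ S.*-congʳ {Q⁻¹} (S.*-comm F Q) ⟩
  Q *ₛ F *ₛ Q⁻¹      ≈⟨ S.*-congʳ {Q⁻¹} e ⟩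
  P *ₛ Q⁻¹           ∎
  where open ≈-Reasoning S.setoid

private module ∑ₚ = FiniteSums Poly-commutativeRing ℤ→Poly

y^≈ : ∀ s → y^ s ≃ₚ (y^ 1) ∑ₚ.^ s
y^≈ zero    = P.refl
y^≈ (suc s) = P.trans shifted (P.*-congˡ {y^ 1} (y^≈ s))
  where
  shifted : (+ 0 ∷ y^ s) ≃ₚ y^ 1 *ₚ y^ s
  shifted = coeffwise λ where
    zero    → sym (trans (coeff-+ (map (+ 0 ℤ.*_) (y^ s)) _ 0) (trans (ℤ.+-identityʳ _) (coeff-map refl (y^ s) 0)))
    (suc i) → sym (trans (coeff-+ (map (+ 0 ℤ.*_) (y^ s)) _ (suc i)) (trans
      (cong₂ ℤ._+_ (coeff-map refl (y^ s) (suc i)) (P.*-identityˡ (y^ s) .coefficient i)) (ℤ.+-identityˡ _)))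

module _ (k : ℕ) where
  open ∑ₚ using (∑; ∑-cong; ∑-map; ∑-↭)
  private module T = Transfer Poly-commutativeRing ℤ→Poly k (y^ 1)

  T-suc : ∀ n → T k (suc n) ≃ₚ T.total (T.state n)
  T-suc n = begin
    ∑ ts (λ t → y^ ρ t)
      ≈⟨ ∑-cong ts (λ t → P.trans (y^≈ (ρ t)) (P.reflexive (cong ((y^ 1) ∑ₚ.^_) (ρ≡blocks t)))) ⟩
    ∑ ts (λ t → (y^ 1) ∑ₚ.^ blocks (coloring t))
      ≈⟨ ∑-map coloring ts (λ c → (y^ 1) ∑ₚ.^ blocks c) ⟨
    ∑ (map coloring ts) (λ c → (y^ 1) ∑ₚ.^ blocks c)
      ≈⟨ ∑-↭ (λ c → (y^ 1) ∑ₚ.^ blocks c) (colorings↭ (suc n)) ⟩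
    ∑ (words (columns k) (suc n)) (λ c → (y^ 1) ∑ₚ.^ blocks c)
      ≈⟨ T.∑-colorings n ⟩
    T.total (T.state n) ∎
    where
    open ≈-Reasoning P.setoid
    ts = 𝒯 k (U-finite (suc n))

  -- The sum over n of x^n (M^n e) i, where e is the vector of ones. Together the three series solve
  -- v = e + x M v.
  component : Fin 3 → Series
  component i n = lookup (T.state n) i

  parameters : Vec Series 2
  parameters = #ₛ k ∷ Y ∷ []

  env : Vec Series 6
  env = parameters Vec.++ (component (# 0) ∷ component (# 1) ∷ component (# 2) ∷ X ∷ [])

  -- Coefficient extraction for one matrix entry. The two renamings place it among the six variables
  -- of `Cramer` and the five of `Transfer`.
  entry : ∀ t F n → (ES.⟦ rename (Fin._↑ˡ 4) t ⟧ env *ₛ F) n ≃ₚ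
                    EP.⟦ rename (Fin._↑ˡ 3) t ⟧ (T.env (T.state n)) *ₚ F n
  entry t F n = begin
    (ES.⟦ rename (Fin._↑ˡ 4) t ⟧ env *ₛ F) n
      ≡⟨ cong (λ G → (G *ₛ F) n) (ES.⟦⟧-rename-↑ˡ t parameters _) ⟩
    (ES.⟦ t ⟧ parameters *ₛ F) n
      ≈⟨ S.*-congʳ {F} (constant-⟦⟧ t κy parameters (λ { zero → termwise (#≈constant k) ; (suc zero) → termwise λ { zero → P.refl ; (suc _) → P.refl } })) .term n ⟩
    (constant (EP.⟦ t ⟧ κy) *ₛ F) n
      ≈⟨ constant-*ₛ (EP.⟦ t ⟧ κy) F n ⟩
    EP.⟦ t ⟧ κy *ₚ F n
      ≡⟨ cong (_*ₚ F n) (EP.⟦⟧-rename-↑ˡ t κy (T.state n)) ⟨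
    EP.⟦ rename (Fin._↑ˡ 3) t ⟧ (T.env (T.state n)) *ₚ F n ∎
    where
    open ≈-Reasoning P.setoid
    κy : Vec Poly 2
    κy = (+ k ∷ []) ∷ y^ 1 ∷ []

  row-coefficient : ∀ ts n → ES.⟦ Cramer.rowᵉ ts ⟧ env n ≃ₚ EP.⟦ T.row ts ⟧ (T.env (T.state n))
  row-coefficient (a ∷ b ∷ c ∷ []) n = P.+-cong (P.+-cong
    (entry (tabulated a) (component (# 0)) n) (entry (tabulated b) (component (# 1)) n))
    (entry (tabulated c) (component (# 2)) n)

  component-recurrence : ∀ i → component i ≃ₛ #ₛ 1 +ₛ X *ₛ ES.⟦ Cramer.rowᵉ (lookup transferᵗ i) ⟧ env
  component-recurrence i = X*-unique
    (P.reflexive (Vec.lookup-replicate i (+ 1 ∷ [])))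
    (λ n → P.trans (P.reflexive (Vec.lookup∘tabulate (λ i → EP.⟦ T.row (lookup transferᵗ i) ⟧ (T.env (T.state n))) i)) (P.sym (row-coefficient (lookup transferᵗ i) n)))

  residual≈1 : ∀ i → ES.⟦ Cramer.residual i ⟧ env ≃ₛ #ₛ 1
  residual≈1 zero             = remainder (component-recurrence (# 0))
  residual≈1 (suc zero)       = remainder (component-recurrence (# 1))
  residual≈1 (suc (suc zero)) = remainder (component-recurrence (# 2))

  T≈ : T k ≃ₛ X *ₛ ES.⟦ Cramer.rowᵉ firstᵗ ⟧ env
  T≈ = termwise λ
    { zero    → P.sym (X*-zero first)
    ; (suc n) → P.trans (T-suc n) (P.sym (P.trans (X*-suc first n) (row-coefficient firstᵗ n))) }
    where first = ES.⟦ Cramer.rowᵉ firstᵗ ⟧ env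

  q*T≈p : q k *ₛ T k ≃ₛ p k
  q*T≈p = S.trans (S.*-congˡ {q k} T≈) (Cramer.cramer Series-commutativeRing ℤ→Series env residual≈1)

  rational : T k ≈ p k / q k
  rational = q⁻¹ , unwrap {q k *ₛ q⁻¹} {#ₛ 1} inverse , unwrap {T k} {p k *ₛ q⁻¹} (quotient {T k} {p k} {q k} inverse q*T≈p)
    where
    -- `q` has the shape 1 - x h, so the geometric iteration inverts it.
    h = ES.⟦ Cramer.codenominator ⟧ env
    q⁻¹ = ℤ[y]⟦x⟧.geometric h
    inverse : q k *ₛ q⁻¹ ≃ₛ #ₛ 1
    inverse = 1-X*-inverse h
    unwrap : ∀ {F G} → F ≃ₛ G → F PowerSeries.≈ G
    unwrap e n = e .term n .coefficient

-- The value at y = 1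

eval-+ : ∀ f g a → eval (f +ₚ g) a ≡ eval f a ℤ.+ eval g a
eval-+ []      g       a = sym (ℤ.+-identityˡ _)
eval-+ (b ∷ f) []      a = sym (ℤ.+-identityʳ _)
eval-+ (b ∷ f) (c ∷ g) a = trans
  (cong (λ e → b ℤ.+ c ℤ.+ e) (trans (cong (a ℤ.*_) (eval-+ f g a)) (ℤ.*-distribˡ-+ a _ _)))
  (interchange b c (a ℤ.* eval f a) (a ℤ.* eval g a))
  where open import Algebra.Properties.CommutativeSemigroup ℤ.+-commutativeSemigroup using (interchange)

eval-y^ : ∀ s → eval (y^ s) (+ 1) ≡ + 1
eval-y^ zero    = refl
eval-y^ (suc s) = trans (ℤ.+-identityˡ _) (trans (ℤ.*-identityˡ _) (eval-y^ s))

eval-sum-y^ : ∀ {A : Set} (f : A → ℕ) xs → eval (sumₚ (map (λ x → y^ f x) xs)) (+ 1) ≡ + length xs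
eval-sum-y^ f []       = refl
eval-sum-y^ f (x ∷ xs) = trans (eval-+ (y^ f x) _ (+ 1)) (cong₂ ℤ._+_ (eval-y^ (f x)) (eval-sum-y^ f xs))

open import Data.Nat using (_*_; _^_)

length-words : ∀ {A : Set} (xs : List A) n → length (words xs n) ≡ length xs ^ n
length-words xs zero    = refl
length-words xs (suc n) = trans (length-product xs) (cong (length xs *_) (length-words xs n))
  where
  length-product : ∀ ys → length (cartesianProductWith _∷_ ys (words xs n)) ≡ length ys * length (words xs n)
  length-product []       = refl
  length-product (y ∷ ys) = trans (length-++ (map (y ∷_) (words xs n)))
    (cong₂ ℕ._+_ (length-map (y ∷_) (words xs n)) (length-product ys))

length-𝒯 : ∀ k n → length (𝒯 k (U-finite n)) ≡ k ^ (3 * n)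
length-𝒯 k n = begin
  length (𝒯 k (U-finite n))                 ≡⟨ length-map coloring (𝒯 k (U-finite n)) ⟨
  length (map coloring (𝒯 k (U-finite n)))  ≡⟨ ↭-length (colorings↭ n) ⟩
  length (words (columns k) n)              ≡⟨ length-words (columns k) n ⟩
  length (columns k) ^ n                    ≡⟨ cong (_^ n) (length-words (allFin k) 3) ⟩
  (length (allFin k) ^ 3) ^ n               ≡⟨ cong (λ m → (m ^ 3) ^ n) (length-tabulate {n = k} (λ i → i)) ⟩
  (k ^ 3) ^ n                               ≡⟨ ℕ.^-*-assoc k 3 n ⟩
  k ^ (3 * n)                               ∎
  where open ≡.≡-Reasoning

theorem6p1 : (k : ℕ) → 1 ≤ k →
    (T k ≈ p k / q k) × ((n : ℕ) → 1 ≤ n → (T k [y≔ + 1 ]) n ≡ + (k ^ (3 * n)))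
theorem6p1 k _ = rational k , λ { n@(suc _) _ → trans (eval-sum-y^ ρ (𝒯 k (U-finite n))) (cong +_ (length-𝒯 k n)) }
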